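{- Let $p$ be an odd prime. Define power series $\sum_{n\ge0}\gamma_1(n)q^n$, $\sum_{n\ge0}\gamma_2(n)q^n$, $\sum_{n\ge0}\gamma_3(n)q^n$ by \[ \sum_{n=0}^{\infty}\gamma_{1}(n)q^n=\left(q,q^2,\ldots,q^{p-1};q^{p}\right)_{\infty},\qquad \sum_{n=0}^{\infty}\gamma_2(n)q^n=\frac{\left(q,q^2,\ldots,q^{p-1};q^{p}\right)_{\infty}^{2}}{\left(q^2,q^4,\ldots,q^{2(p-1)};q^{2p}\right)_{\infty}}, \] \[ \sum_{n=0}^{\infty}\gamma_3(n)q^n=\frac{\left(q^2,q^4,\ldots,q^{2(p-1)};q^{2p}\right)_{\infty}^{2}}{\left(q,q^2,\ldots,q^{p-1};q^{p}\right)_{\infty}}, \] and let $\gamma_j'(n)$ denote the coefficient of $q^n$ in the reciprocal $\left(\sum_{n\ge0}\gamma_j(n)q^n\right)^{ -1}$. Then for all $n\ge0$: (i) if $p>3$, $\gamma_{1}\!\left(pn+\frac{p^2-1}{24}\right)=(-1)^{\epsilon}\gamma_{1}^{\prime}(n)$, where $\epsilon=\frac{p+1}{6}$ if $p\equiv 5 \pmod 6$ and $\epsilon=\frac{p-1}{6}$ if $p\equiv 1\pmod 6$ (i.e. $\epsilon=\frac{p\pm1}{6}$ with the sign chosen so that it is an integer); (ii) $\gamma_2(pn)=\gamma^{\prime}_{2}(n)$; (iii) $\gamma_3\!\left(pn+\frac{p^2-1}{8}\right)=\gamma^{\prime}_{3}(n)$.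
   Context: $q$ is a formal variable (or complex with $|q|<1$). $(a;q)_\infty=\prod_{j\ge0}(1-aq^j)$ and $(a_1,\dots,a_m;q)_\infty=(a_1;q)_\infty\cdots(a_m;q)_\infty$. All series considered have constant term $1$, so their reciprocals are power series in $q$. -}

module Defs where

open import Data.Nat as ℕ using (ℕ; zero; suc; _≟_)
open import Data.Integer as ℤ using (ℤ; +_; -_)
open import Relation.Binary.PropositionalEquality using (_≡_)
open import Relation.Nullary using (yes; no)

Series : Set
Series = ℕ → ℤ

_≈ₛ_ : Series → Series → Set
f ≈ₛ g = ∀ n → f n ≡ g n

oneₛ : Series
oneₛ zero    = + 1
oneₛ (suc _) = + 0

Σ< : ℕ → (ℕ → ℤ) → ℤ
Σ< zero    f = + 0
Σ< (suc n) f = Σ< n f ℤ.+ f n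

_*ₛ_ : Series → Series → Series
(f *ₛ g) n = Σ< (suc n) (λ k → f k ℤ.* g (n ℕ.∸ k))

∏< : ℕ → (ℕ → Series) → Series
∏< zero    F = oneₛ
∏< (suc n) F = ∏< n F *ₛ F n

oneMinusQ^ : ℕ → Series
oneMinusQ^ e n = δ n 0 ℤ.- δ n e
  where
  δ : ℕ → ℕ → ℤ
  δ a b with a ≟ b
  ... | yes _ = + 1
  ... | no  _ = + 0

-- (q^a ; q^m)_∞ = ∏_{j ≥ 0} (1 - q^{a + m j}), for m ≥ 1.
-- Its coefficient of q^n equals that of the truncated product over j ≤ n,
-- since the remaining factors are 1 + O(q^{n+1}) when m ≥ 1.
poch : ℕ → ℕ → Series
poch a m n = ∏< (suc n) (λ j → oneMinusQ^ (a ℕ.+ m ℕ.* j)) n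

multiPoch : ℕ → ℕ → Series
multiPoch p c = ∏< (p ℕ.∸ 1) (λ i → poch (c ℕ.* suc i) (c ℕ.* p))

Aₚ : ℕ → Series
Aₚ p = multiPoch p 1

Bₚ : ℕ → Series
Bₚ p = multiPoch p 2

epsilon : ℕ → ℕ
epsilon p with p ℕ.% 6 ≟ 5
... | yes _ = (p ℕ.+ 1) ℕ./ 6
... | no  _ = (p ℕ.∸ 1) ℕ./ 6

{-# OPTIONS --safe #-}
module Submission where

-- Let E(q) = (q; q)_∞, so that Aₚ = E(q)/E(q^p) and Bₚ = E(q²)/E(q^{2p}). For γ₁, γ₂, γ₃ take respectively
-- Θ = E(q), E(q)²/E(q²), E(q²)²/E(q); in each case γ(q) Θ(q^p) = Θ(q). By Euler and Gauss,
-- Θ = Σ_w g(w) q^{(w² - c)/M} with (M, c) = (24, 1), (1, 0), (8, 1), and g(pw) = χ g(w) for a sign χ.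
-- An exponent congruent to c(p² - 1)/M mod p comes from some w divisible by p, so extracting these exponents
-- turns Θ(q) into χ Θ(q^p), and turns γ(q) Θ(q^p) into G(q) Θ(q), where G collects the coefficients
-- γ(pn + c(p² - 1)/M). Hence G(q) = χ Θ(q^p)/Θ(q) = χ/γ(q).
-- The expansions of Θ are limits of finite identities in the style of Shanks, for sums over s ≤ k that
-- depend on a second parameter n and telescope when n is increased.

open import Defs
open import Algebra.Bundles using (AbelianGroup; CommutativeRing)
import Algebra.Solver.Ring
open import Algebra.Solver.Ring.AlmostCommutativeRing using (fromCommutativeRing; _-Raw-AlmostCommutative⟶_)
open import Data.Empty using (⊥; ⊥-elim)
open import Data.Integer as ℤ using (ℤ; -[1+_]; +_)
import Data.Integer.Properties as ℤ
import Data.Integer.Solver as ℤ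
open import Data.Maybe using (Maybe; just; nothing)
open import Data.Nat as ℕ using (ℕ; zero; suc; _<_; _≤_; z≤n; s≤s; NonZero)
open import Data.Nat.Divisibility using (_∣_; _∣?_; divides; ∣m+n∣m⇒∣n; n∣m*n; m∣m*n; >⇒∤)
open import Data.Nat.DivMod using (m≡m%n+[m/n]*n; m%n<n; m*n/n≡m; [m+kn]%n≡m%n; %-distribˡ-*)
open import Data.Nat.Primality using (Prime; euclidsLemma; prime⇒nonZero; prime⇒nonTrivial; prime⇒irreducible)
import Data.Nat.Properties as ℕ
open import Data.Nat.Tactic.RingSolver using (solve-∀)
open import Data.Product using (∃; _×_; _,_)
open import Data.Sum using (inj₁; inj₂)
open import Level using (0ℓ)
open import Relation.Binary.Definitions using (tri<; tri≈; tri>)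
open import Relation.Binary.PropositionalEquality hiding (setoid)
open import Relation.Nullary using (¬_; Dec; yes; no)
open import Relation.Nullary.Decidable using (toWitness)

infix 4 _≈[_]_
infixl 7 _∙_
infixl 6 _⊕_
infix 8 ⊖_

-- The ring of power series

-- No reciprocal is ever constructed: `γ` and `γ′` are arbitrary series tied by a product equation,
-- and the quotients defining γ₂ and γ₃ enter in cross-multiplied form. Divisions therefore become
-- multiplications by `γ′` or cancellations of a factor with constant term 1. Infinite products
-- cause a detour, because `poch` takes a different number of factors for each coefficient. Their
-- identities are proved modulo q^(N+1), where N factors suffice, and the arbitrary cutoff N gives
-- back equality of series. The sign χ is χ₁₂(p) for γ₁, by complete multiplicativity of χ₁₂, and 1
-- in the other two cases. The offset c(p² - 1)/M can exceed p. It is split as r₁ p + r₀ with r₀ <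
-- p, so the section of residue r₀ has r₁ extra leading places. These must be shown to be empty, and
-- they account for a factor q^(r₁).

Σ<-cong : ∀ n {f g : ℕ → ℤ} → (∀ {k} → k < n → f k ≡ g k) → Σ< n f ≡ Σ< n g
Σ<-cong zero    eq = refl
Σ<-cong (suc n) eq = cong₂ ℤ._+_ (Σ<-cong n (λ k<n → eq (ℕ.m<n⇒m<1+n k<n))) (eq ℕ.≤-refl)

Σ<-zero : ∀ n {f : ℕ → ℤ} → (∀ {k} → k < n → f k ≡ + 0) → Σ< n f ≡ + 0
Σ<-zero zero    eq = refl
Σ<-zero (suc n) eq = cong₂ ℤ._+_ (Σ<-zero n (λ k<n → eq (ℕ.m<n⇒m<1+n k<n))) (eq ℕ.≤-refl)

Σ<-+ : ∀ n (f g : ℕ → ℤ) → Σ< n (λ k → f k ℤ.+ g k) ≡ Σ< n f ℤ.+ Σ< n g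
Σ<-+ zero    f g = refl
Σ<-+ (suc n) f g rewrite Σ<-+ n f g =
  solve 4 (λ a b c d → (a :+ b) :+ (c :+ d) := (a :+ c) :+ (b :+ d)) refl (Σ< n f) (Σ< n g) (f n) (g n)
  where open ℤ.+-*-Solver

Σ<-*ˡ : ∀ n c (f : ℕ → ℤ) → Σ< n (λ k → c ℤ.* f k) ≡ c ℤ.* Σ< n f
Σ<-*ˡ zero    c f = sym (ℤ.*-zeroʳ c)
Σ<-*ˡ (suc n) c f rewrite Σ<-*ˡ n c f = sym (ℤ.*-distribˡ-+ c (Σ< n f) (f n))

Σ<-++ : ∀ m n (f : ℕ → ℤ) → Σ< (m ℕ.+ n) f ≡ Σ< m f ℤ.+ Σ< n (λ k → f (m ℕ.+ k))
Σ<-++ m zero    f rewrite ℕ.+-identityʳ m = sym (ℤ.+-identityʳ _)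
Σ<-++ m (suc n) f rewrite ℕ.+-suc m n | Σ<-++ m n f = ℤ.+-assoc (Σ< m f) _ _

tail : Series → Series
tail f n = f (suc n)

zeroₛ : Series
zeroₛ _ = + 0

_⊕_ : Series → Series → Series
(f ⊕ g) n = f n ℤ.+ g n

⊖_ : Series → Series
(⊖ f) n = ℤ.- f n

_∙_ : ℤ → Series → Series
(c ∙ f) n = c ℤ.* f n

-- Coefficient n of a product involves only coefficients up to n of the factors; this is what makes
-- equality modulo q^(N+1) a ring congruence.
*ₛ-cong-≤ : ∀ n {f f′ g g′} → (∀ {k} → k ≤ n → f k ≡ f′ k) → (∀ {k} → k ≤ n → g k ≡ g′ k) →
            (f *ₛ g) n ≡ (f′ *ₛ g′) n
*ₛ-cong-≤ n f≡f′ g≡g′ = Σ<-cong (suc n) λ {k} k<1+n →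
  cong₂ ℤ._*_ (f≡f′ (ℕ.≤-pred k<1+n)) (g≡g′ (ℕ.m∸n≤m n k))

*ₛ-cong : ∀ {f f′ g g′} → f ≈ₛ f′ → g ≈ₛ g′ → (f *ₛ g) ≈ₛ (f′ *ₛ g′)
*ₛ-cong f≈f′ g≈g′ n = *ₛ-cong-≤ n (λ {k} _ → f≈f′ k) (λ {k} _ → g≈g′ k)

*ₛ-zeroth : ∀ f g → (f *ₛ g) 0 ≡ f 0 ℤ.* g 0
*ₛ-zeroth f g = ℤ.+-identityˡ _

-- From f = f(0) + q · `tail f`. Peeling off a constant term reduces commutativity and associativity
-- to induction on the coefficient, with no exchange of double sums.
*ₛ-sucˡ : ∀ f g n → (f *ₛ g) (suc n) ≡ f 0 ℤ.* g (suc n) ℤ.+ (tail f *ₛ g) n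
*ₛ-sucˡ f g n = trans (Σ<-++ 1 (suc n) _)
  (cong (ℤ._+ (tail f *ₛ g) n) (ℤ.+-identityˡ (f 0 ℤ.* g (suc n))))

*ₛ-sucʳ : ∀ f g n → (f *ₛ g) (suc n) ≡ (f *ₛ tail g) n ℤ.+ f (suc n) ℤ.* g 0
*ₛ-sucʳ f g n = cong₂ ℤ._+_
  (Σ<-cong (suc n) λ {k} k<1+n → cong (λ i → f k ℤ.* g i) (ℕ.+-∸-assoc 1 (ℕ.≤-pred k<1+n)))
  (cong (λ i → f (suc n) ℤ.* g i) (ℕ.n∸n≡0 n))

*ₛ-comm : ∀ f g → (f *ₛ g) ≈ₛ (g *ₛ f)
*ₛ-comm f g zero    = cong (λ x → + 0 ℤ.+ x) (ℤ.*-comm (f 0) (g 0))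
*ₛ-comm f g (suc n) = begin
  (f *ₛ g) (suc n)                            ≡⟨ *ₛ-sucˡ f g n ⟩
  f 0 ℤ.* g (suc n) ℤ.+ (tail f *ₛ g) n       ≡⟨ cong₂ ℤ._+_ (ℤ.*-comm (f 0) _) (*ₛ-comm (tail f) g n) ⟩
  g (suc n) ℤ.* f 0 ℤ.+ (g *ₛ tail f) n       ≡⟨ ℤ.+-comm (g (suc n) ℤ.* f 0) _ ⟩
  (g *ₛ tail f) n ℤ.+ g (suc n) ℤ.* f 0       ≡⟨ *ₛ-sucʳ g f n ⟨
  (g *ₛ f) (suc n)                            ∎
  where open ≡-Reasoning

*ₛ-distribʳ : ∀ f g h → ((g ⊕ h) *ₛ f) ≈ₛ ((g *ₛ f) ⊕ (h *ₛ f))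
*ₛ-distribʳ f g h n = trans
  (Σ<-cong (suc n) λ {k} _ → ℤ.*-distribʳ-+ (f (n ℕ.∸ k)) (g k) (h k))
  (Σ<-+ (suc n) _ _)

∙-*ₛ-assoc : ∀ c f g → ((c ∙ f) *ₛ g) ≈ₛ (c ∙ (f *ₛ g))
∙-*ₛ-assoc c f g n = trans
  (Σ<-cong (suc n) λ {k} _ → ℤ.*-assoc c (f k) (g (n ℕ.∸ k)))
  (Σ<-*ˡ (suc n) c _)

*ₛ-assoc : ∀ f g h → ((f *ₛ g) *ₛ h) ≈ₛ (f *ₛ (g *ₛ h))
*ₛ-assoc f g h zero = begin
  ((f *ₛ g) *ₛ h) 0          ≡⟨ *ₛ-zeroth (f *ₛ g) h ⟩
  (f *ₛ g) 0 ℤ.* h 0         ≡⟨ cong (ℤ._* h 0) (*ₛ-zeroth f g) ⟩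
  f 0 ℤ.* g 0 ℤ.* h 0        ≡⟨ ℤ.*-assoc (f 0) (g 0) (h 0) ⟩
  f 0 ℤ.* (g 0 ℤ.* h 0)      ≡⟨ cong (f 0 ℤ.*_) (*ₛ-zeroth g h) ⟨
  f 0 ℤ.* (g *ₛ h) 0         ≡⟨ *ₛ-zeroth f (g *ₛ h) ⟨
  (f *ₛ (g *ₛ h)) 0          ∎
  where open ≡-Reasoning
*ₛ-assoc f g h (suc n) = begin
  ((f *ₛ g) *ₛ h) (suc n)
    ≡⟨ *ₛ-sucˡ (f *ₛ g) h n ⟩
  (f *ₛ g) 0 ℤ.* h (suc n) ℤ.+ (tail (f *ₛ g) *ₛ h) n
    ≡⟨ cong₂ ℤ._+_ (cong (ℤ._* h (suc n)) (*ₛ-zeroth f g))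
         (trans (*ₛ-cong {g = h} (*ₛ-sucˡ f g) (λ _ → refl) n)
           (*ₛ-distribʳ h (f 0 ∙ tail g) (tail f *ₛ g) n)) ⟩
  f 0 ℤ.* g 0 ℤ.* h (suc n) ℤ.+ (((f 0 ∙ tail g) *ₛ h) n ℤ.+ ((tail f *ₛ g) *ₛ h) n)
    ≡⟨ cong₂ (λ x y → f 0 ℤ.* g 0 ℤ.* h (suc n) ℤ.+ (x ℤ.+ y))
         (∙-*ₛ-assoc (f 0) (tail g) h n) (*ₛ-assoc (tail f) g h n) ⟩
  f 0 ℤ.* g 0 ℤ.* h (suc n) ℤ.+ (f 0 ℤ.* (tail g *ₛ h) n ℤ.+ (tail f *ₛ (g *ₛ h)) n)
    ≡⟨ solve 5 (λ a b c d e → a :* b :* c :+ (a :* d :+ e) := a :* (b :* c :+ d) :+ e) refl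
         (f 0) (g 0) (h (suc n)) ((tail g *ₛ h) n) ((tail f *ₛ (g *ₛ h)) n) ⟩
  f 0 ℤ.* (g 0 ℤ.* h (suc n) ℤ.+ (tail g *ₛ h) n) ℤ.+ (tail f *ₛ (g *ₛ h)) n
    ≡⟨ cong (λ x → f 0 ℤ.* x ℤ.+ (tail f *ₛ (g *ₛ h)) n) (*ₛ-sucˡ g h n) ⟨
  f 0 ℤ.* (g *ₛ h) (suc n) ℤ.+ (tail f *ₛ (g *ₛ h)) n
    ≡⟨ *ₛ-sucˡ f (g *ₛ h) n ⟨
  (f *ₛ (g *ₛ h)) (suc n) ∎
  where
  open ≡-Reasoning
  open ℤ.+-*-Solver

*ₛ-identityˡ : ∀ f → (oneₛ *ₛ f) ≈ₛ f
*ₛ-identityˡ f zero    = trans (*ₛ-zeroth oneₛ f) (ℤ.*-identityˡ (f 0))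
*ₛ-identityˡ f (suc n) = begin
  (oneₛ *ₛ f) (suc n)                           ≡⟨ *ₛ-sucˡ oneₛ f n ⟩
  + 1 ℤ.* f (suc n) ℤ.+ (tail oneₛ *ₛ f) n      ≡⟨ cong₂ ℤ._+_ (ℤ.*-identityˡ (f (suc n))) (Σ<-zero (suc n) λ _ → refl) ⟩
  f (suc n) ℤ.+ + 0                             ≡⟨ ℤ.+-identityʳ _ ⟩
  f (suc n)                                     ∎
  where open ≡-Reasoning

-- A record rather than a function type, so that the series and the cutoff can be read off the type.
record _≈[_]_ (f : Series) (N : ℕ) (g : Series) : Set where
  constructor modulo
  field coeff : ∀ {n} → n ≤ N → f n ≡ g n

open _≈[_]_ public

≈ₛ⇒≈ : ∀ {N f g} → f ≈ₛ g → f ≈[ N ] g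
≈ₛ⇒≈ f≈g = modulo λ {n} _ → f≈g n

≈⇒≈ₛ : ∀ {f g} → (∀ N → f ≈[ N ] g) → f ≈ₛ g
≈⇒≈ₛ f≈g n = coeff (f≈g n) ℕ.≤-refl

-- ℤ[[q]] / (q^{N+1}), presented as ℤ[[q]] with a coarser equality.
truncatedRing : ℕ → CommutativeRing 0ℓ 0ℓ
truncatedRing N = record
  { Carrier = Series
  ; _≈_ = _≈[ N ]_
  ; _+_ = _⊕_
  ; _*_ = _*ₛ_
  ; -_ = ⊖_
  ; 0# = zeroₛ
  ; 1# = oneₛ
  ; isCommutativeRing = record
    { isRing = record
      { +-isAbelianGroup = record
        { isGroup = record
          { isMonoid = record
            { isSemigroup = record
              { isMagma = record
                { isEquivalence = record
                  { refl = modulo λ _ → refl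
                  ; sym = λ f≈g → modulo λ n≤N → sym (coeff f≈g n≤N)
                  ; trans = λ f≈g g≈h → modulo λ n≤N → trans (coeff f≈g n≤N) (coeff g≈h n≤N)
                  }
                ; ∙-cong = λ f≈f′ g≈g′ → modulo λ n≤N → cong₂ ℤ._+_ (coeff f≈f′ n≤N) (coeff g≈g′ n≤N)
                }
              ; assoc = λ f g h → ≈ₛ⇒≈ λ n → ℤ.+-assoc (f n) (g n) (h n)
              }
            ; identity = (λ f → ≈ₛ⇒≈ λ n → ℤ.+-identityˡ (f n)) , (λ f → ≈ₛ⇒≈ λ n → ℤ.+-identityʳ (f n))
            }
          ; inverse = (λ f → ≈ₛ⇒≈ λ n → ℤ.+-inverseˡ (f n)) , (λ f → ≈ₛ⇒≈ λ n → ℤ.+-inverseʳ (f n))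
          ; ⁻¹-cong = λ f≈g → modulo λ n≤N → cong ℤ.-_ (coeff f≈g n≤N)
          }
        ; comm = λ f g → ≈ₛ⇒≈ λ n → ℤ.+-comm (f n) (g n)
        }
      ; *-cong = λ f≈f′ g≈g′ → modulo λ {n} n≤N → *ₛ-cong-≤ n
          (λ k≤n → coeff f≈f′ (ℕ.≤-trans k≤n n≤N)) (λ k≤n → coeff g≈g′ (ℕ.≤-trans k≤n n≤N))
      ; *-assoc = λ f g h → ≈ₛ⇒≈ (*ₛ-assoc f g h)
      ; *-identity = (λ f → ≈ₛ⇒≈ (*ₛ-identityˡ f))
                   , (λ f → ≈ₛ⇒≈ λ n → trans (*ₛ-comm f oneₛ n) (*ₛ-identityˡ f n))
      ; distrib = (λ f g h → ≈ₛ⇒≈ λ n → begin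
          (f *ₛ (g ⊕ h)) n                  ≡⟨ *ₛ-comm f (g ⊕ h) n ⟩
          ((g ⊕ h) *ₛ f) n                  ≡⟨ *ₛ-distribʳ f g h n ⟩
          (g *ₛ f) n ℤ.+ (h *ₛ f) n         ≡⟨ cong₂ ℤ._+_ (*ₛ-comm g f n) (*ₛ-comm h f n) ⟩
          (f *ₛ g) n ℤ.+ (f *ₛ h) n         ∎)
        , (λ f g h → ≈ₛ⇒≈ (*ₛ-distribʳ f g h))
      }
    ; *-comm = λ f g → ≈ₛ⇒≈ (*ₛ-comm f g)
    }
  }
  where open ≡-Reasoning

-- The unit coefficient is sent to oneₛ itself, so that con (+ 1) in the ring solver reads back as oneₛ.
fromℤ : ℤ → Series
fromℤ (+ 0) = zeroₛ
fromℤ (+ 1) = oneₛ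
fromℤ c     = c ∙ oneₛ

fromℤ-∙ : ∀ c → fromℤ c ≈ₛ (c ∙ oneₛ)
fromℤ-∙ (+ 0)            n = refl
fromℤ-∙ (+ 1)            n = sym (ℤ.*-identityˡ (oneₛ n))
fromℤ-∙ (+ suc (suc c))  n = refl
fromℤ-∙ -[1+ c ]         n = refl

module Truncated (N : ℕ) where
  open CommutativeRing (truncatedRing N) public
    using (_≈_; +-cong; *-cong; -‿cong; setoid; *-comm; reflexive)
    renaming (refl to ≈-refl; sym to ≈-sym; trans to ≈-trans)
  open import Relation.Binary.Reasoning.Setoid setoid public

  -- Unification cannot recover h from h *ₛ f, a function of the exponent that Agda eta-expands and unfolds.
  *-congˡ : ∀ h {f g} → f ≈ g → (h *ₛ f) ≈ (h *ₛ g)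
  *-congˡ h f≈g = *-cong {h} {h} ≈-refl f≈g

  *-congʳ : ∀ h {f g} → f ≈ g → (f *ₛ h) ≈ (g *ₛ h)
  *-congʳ h f≈g = *-cong {u = h} {h} f≈g ≈-refl

  +-congˡ : ∀ h {f g} → f ≈ g → (h ⊕ f) ≈ (h ⊕ g)
  +-congˡ h f≈g = +-cong {h} {h} ≈-refl f≈g

  +-congʳ : ∀ h {f g} → f ≈ g → (f ⊕ h) ≈ (g ⊕ h)
  +-congʳ h f≈g = +-cong {u = h} {h} f≈g ≈-refl

  fromℤ-morphism : CommutativeRing.rawRing ℤ.+-*-commutativeRing
                   -Raw-AlmostCommutative⟶ fromCommutativeRing (truncatedRing N)
  fromℤ-morphism = record
    { ⟦_⟧ = fromℤ
    ; +-homo = λ a b → ≈ₛ⇒≈ λ n → trans (fromℤ-∙ (a ℤ.+ b) n)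
        (trans (ℤ.*-distribʳ-+ (oneₛ n) a b) (sym (cong₂ ℤ._+_ (fromℤ-∙ a n) (fromℤ-∙ b n))))
    ; *-homo = λ a b → ≈ₛ⇒≈ λ n → trans (fromℤ-∙ (a ℤ.* b) n) (trans (ℤ.*-assoc a b (oneₛ n))
        (sym (trans (*ₛ-cong (fromℤ-∙ a) (fromℤ-∙ b) n) (trans (∙-*ₛ-assoc a oneₛ (b ∙ oneₛ) n)
          (cong (a ℤ.*_) (*ₛ-identityˡ (b ∙ oneₛ) n))))))
    ; -‿homo = λ a → ≈ₛ⇒≈ λ n → trans (fromℤ-∙ (ℤ.- a) n)
        (trans (sym (ℤ.neg-distribˡ-* a (oneₛ n))) (cong ℤ.-_ (sym (fromℤ-∙ a n))))
    ; 0-homo = ≈-refl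
    ; 1-homo = ≈-refl
    }

  fromℤ-≟ : ∀ a b → Maybe (fromℤ a ≈ fromℤ b)
  fromℤ-≟ a b with a ℤ.≟ b
  ... | yes refl = just ≈-refl
  ... | no _     = nothing

  open Algebra.Solver.Ring (CommutativeRing.rawRing ℤ.+-*-commutativeRing)
    (fromCommutativeRing (truncatedRing N)) fromℤ-morphism fromℤ-≟ public
    using (solve; _:=_; _:+_; _:*_; _:-_; :-_; con)

-- Monomials and the pentagonal number theorem

-- Copy of the `δ` that is local to `oneMinusQ^`; `oneMinusQ^-q^` links the two.
δ : ℕ → ℕ → ℤ
δ a b with a ℕ.≟ b
... | yes _ = + 1
... | no  _ = + 0

δ-≡ : ∀ {a b} → a ≡ b → δ a b ≡ + 1
δ-≡ {a} {b} a≡b with a ℕ.≟ b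
... | yes _   = refl
... | no  a≢b = ⊥-elim (a≢b a≡b)

δ-≢ : ∀ {a b} → a ≢ b → δ a b ≡ + 0
δ-≢ {a} {b} a≢b with a ℕ.≟ b
... | yes a≡b = ⊥-elim (a≢b a≡b)
... | no  _   = refl

δ-cong : ∀ {a b c d} → (a ≡ b → c ≡ d) → (c ≡ d → a ≡ b) → δ a b ≡ δ c d
δ-cong {a} {b} to from with a ℕ.≟ b
... | yes a≡b = sym (δ-≡ (to a≡b))
... | no  a≢b = sym (δ-≢ (λ c≡d → a≢b (from c≡d)))

q^ : ℕ → Series
q^ e n = δ n e

q^0≈1 : q^ 0 ≈ₛ oneₛ
q^0≈1 zero    = refl
q^0≈1 (suc n) = refl

q^-*ₛ-< : ∀ e f {n} → n < e → (q^ e *ₛ f) n ≡ + 0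
q^-*ₛ-< e f {n} n<e = Σ<-zero (suc n) λ {k} k<1+n →
  cong (ℤ._* f (n ℕ.∸ k)) (δ-≢ (ℕ.<⇒≢ (ℕ.<-≤-trans k<1+n n<e)))

q^-*ₛ-suc : ∀ e f n → (q^ (suc e) *ₛ f) (suc n) ≡ (q^ e *ₛ f) n
q^-*ₛ-suc e f n = begin
  (q^ (suc e) *ₛ f) (suc n)                         ≡⟨ *ₛ-sucˡ (q^ (suc e)) f n ⟩
  + 0 ℤ.* f (suc n) ℤ.+ (tail (q^ (suc e)) *ₛ f) n  ≡⟨ ℤ.+-identityˡ _ ⟩
  (tail (q^ (suc e)) *ₛ f) n                        ≡⟨ *ₛ-cong {g = f} (λ i → δ-cong {suc i} ℕ.suc-injective (cong suc)) (λ _ → refl) n ⟩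
  (q^ e *ₛ f) n                                     ∎
  where open ≡-Reasoning

q^-*ₛ-+ : ∀ e f n → (q^ e *ₛ f) (e ℕ.+ n) ≡ f n
q^-*ₛ-+ zero    f n = trans (*ₛ-cong {g = f} q^0≈1 (λ _ → refl) n) (*ₛ-identityˡ f n)
q^-*ₛ-+ (suc e) f n = trans (q^-*ₛ-suc e f (e ℕ.+ n)) (q^-*ₛ-+ e f n)

q^-+ : ∀ d e → q^ (d ℕ.+ e) ≈ₛ (q^ d *ₛ q^ e)
q^-+ zero    e n       = sym (q^-*ₛ-+ 0 (q^ e) n)
q^-+ (suc d) e zero    = refl
q^-+ (suc d) e (suc n) = begin
  δ (suc n) (suc d ℕ.+ e)        ≡⟨ δ-cong {suc n} ℕ.suc-injective (cong suc) ⟩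
  q^ (d ℕ.+ e) n                 ≡⟨ q^-+ d e n ⟩
  (q^ d *ₛ q^ e) n               ≡⟨ q^-*ₛ-suc d (q^ e) n ⟨
  (q^ (suc d) *ₛ q^ e) (suc n)   ∎
  where open ≡-Reasoning

q^-split : ∀ {N c} a b → c ≡ a ℕ.+ b → q^ c ≈[ N ] (q^ a *ₛ q^ b)
q^-split a b refl = ≈ₛ⇒≈ (q^-+ a b)

q^-vanishes : ∀ {N e} → N < e → q^ e ≈[ N ] zeroₛ
q^-vanishes N<e = modulo λ n≤N → δ-≢ (ℕ.<⇒≢ (ℕ.≤-<-trans n≤N N<e))

oneMinusQ^-q^ : ∀ e → oneMinusQ^ e ≈ₛ (oneₛ ⊕ (⊖ q^ e))
oneMinusQ^-q^ e zero    with 0 ℕ.≟ e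
... | yes _ = refl
... | no  _ = refl
oneMinusQ^-q^ e (suc n) with suc n ℕ.≟ e
... | yes _ = refl
... | no  _ = refl

factor : ∀ {N d e} → d ≡ e → (oneₛ ⊕ (⊖ q^ d)) ≈[ N ] oneMinusQ^ e
factor {e = e} refl = modulo λ {n} _ → sym (oneMinusQ^-q^ e n)

-- (q^a; q^m)_k
qPoch : ℕ → ℕ → ℕ → Series
qPoch a m k = ∏< k (λ j → oneMinusQ^ (a ℕ.+ m ℕ.* j))

-- A series rather than an integer scalar: the ring solver takes `sgn k` as an atom σ, and
-- `sgn (suc k)` reduces to the negative of σ.
sgn : ℕ → Series
sgn zero    = oneₛ
sgn (suc k) = ⊖ sgn k

tri : ℕ → ℕ
tri zero    = 0
tri (suc k) = tri k ℕ.+ suc k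

module Pentagonal where

  -- Σ_{s ≤ k} (-1)^s (q; q)_k / (q; q)_s q^{s n + s(s+1)/2}
  shanks : ℕ → ℕ → Series
  shanks zero    n = oneₛ
  shanks (suc k) n = (shanks k n *ₛ (oneₛ ⊕ (⊖ q^ (suc k)))) ⊕ (sgn (suc k) *ₛ q^ (suc k ℕ.* n ℕ.+ tri (suc k)))

  -- For s = n + 1 the exponents are the pentagonal numbers s(3s - 1)/2 and s(3s + 1)/2, left in the
  -- form in which `shanks` produces them at (s, s - 1) and (s, s).
  partialSum : ℕ → Series
  partialSum zero    = oneₛ
  partialSum (suc n) = partialSum n ⊕
    (sgn (suc n) *ₛ (q^ (suc n ℕ.* n ℕ.+ tri (suc n)) ⊕ q^ (suc n ℕ.* suc n ℕ.+ tri (suc n))))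

  module _ (N : ℕ) where
    open Truncated N

    -- Let u_s = (-1)^s (q; q)_k / (q; q)_s q^((s+1)n + (s+1)(s+2)/2). Multiplied by 1 - q^(n+1),
    -- the s-th summand at n + 1 is the s-th summand at n plus u_(s-1) - u_s, where the term u_(s-1)
    -- is absent for s = 0. The sum telescopes and leaves -u_k; induction on k carries this out
    -- without fractions.
    shanks-suc : ∀ k n → ((oneₛ ⊕ (⊖ q^ (suc n))) *ₛ shanks k (suc n)) ≈
                         (shanks k n ⊕ (⊖ (sgn k *ₛ q^ (suc k ℕ.* n ℕ.+ tri (suc k)))))
    shanks-suc zero    n = begin
      (oneₛ ⊕ (⊖ q^ (suc n))) *ₛ oneₛ   ≈⟨ solve 1 (λ x → (con (+ 1) :+ (:- x)) :* con (+ 1)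
                                              := con (+ 1) :+ (:- (con (+ 1) :* x))) ≈-refl (q^ (suc n)) ⟩
      oneₛ ⊕ (⊖ (oneₛ *ₛ q^ (suc n)))   ≡⟨ cong (λ e → oneₛ ⊕ (⊖ (oneₛ *ₛ q^ e))) (lemma n) ⟩
      oneₛ ⊕ (⊖ (oneₛ *ₛ q^ (1 ℕ.* n ℕ.+ 1))) ∎
      where
      lemma : ∀ n → suc n ≡ 1 ℕ.* n ℕ.+ 1
      lemma = solve-∀
    shanks-suc (suc k) n = begin
      (oneₛ ⊕ (⊖ x)) *ₛ ((g′ *ₛ (oneₛ ⊕ (⊖ y))) ⊕ ((⊖ σ) *ₛ q^ (suc k ℕ.* suc n ℕ.+ tri (suc k))))
        ≈⟨ *-congˡ (oneₛ ⊕ (⊖ x)) (+-congˡ (g′ *ₛ (oneₛ ⊕ (⊖ y))) (*-congˡ (⊖ σ) ay)) ⟩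
      (oneₛ ⊕ (⊖ x)) *ₛ ((g′ *ₛ (oneₛ ⊕ (⊖ y))) ⊕ ((⊖ σ) *ₛ (a *ₛ y)))
        ≈⟨ solve 5 (λ x y σ a g′ →
             (con (+ 1) :+ (:- x)) :* ((g′ :* (con (+ 1) :+ (:- y))) :+ ((:- σ) :* (a :* y))) :=
             (((con (+ 1) :+ (:- x)) :* g′) :* (con (+ 1) :+ (:- y))) :+ ((con (+ 1) :+ (:- x)) :* ((:- σ) :* (a :* y))))
             ≈-refl x y σ a g′ ⟩
      (((oneₛ ⊕ (⊖ x)) *ₛ g′) *ₛ (oneₛ ⊕ (⊖ y))) ⊕ ((oneₛ ⊕ (⊖ x)) *ₛ ((⊖ σ) *ₛ (a *ₛ y)))
        ≈⟨ +-congʳ ((oneₛ ⊕ (⊖ x)) *ₛ ((⊖ σ) *ₛ (a *ₛ y))) (*-congʳ (oneₛ ⊕ (⊖ y)) (shanks-suc k n)) ⟩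
      ((g ⊕ (⊖ (σ *ₛ a))) *ₛ (oneₛ ⊕ (⊖ y))) ⊕ ((oneₛ ⊕ (⊖ x)) *ₛ ((⊖ σ) *ₛ (a *ₛ y)))
        ≈⟨ solve 5 (λ x y σ a g →
             ((g :+ (:- (σ :* a))) :* (con (+ 1) :+ (:- y))) :+ ((con (+ 1) :+ (:- x)) :* ((:- σ) :* (a :* y))) :=
             ((g :* (con (+ 1) :+ (:- y))) :+ ((:- σ) :* a)) :+ (:- ((:- σ) :* (a :* (x :* y)))))
             ≈-refl x y σ a g ⟩
      ((g *ₛ (oneₛ ⊕ (⊖ y))) ⊕ ((⊖ σ) *ₛ a)) ⊕ (⊖ ((⊖ σ) *ₛ (a *ₛ (x *ₛ y))))
        ≈⟨ +-congˡ ((g *ₛ (oneₛ ⊕ (⊖ y))) ⊕ ((⊖ σ) *ₛ a)) (-‿cong (*-congˡ (⊖ σ) axy)) ⟨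
      ((g *ₛ (oneₛ ⊕ (⊖ y))) ⊕ ((⊖ σ) *ₛ a)) ⊕ (⊖ ((⊖ σ) *ₛ q^ (suc (suc k) ℕ.* n ℕ.+ tri (suc (suc k))))) ∎
      where
      x y σ a g g′ : Series
      x = q^ (suc n)
      y = q^ (suc k)
      σ = sgn k
      a = q^ (suc k ℕ.* n ℕ.+ tri (suc k))
      g = shanks k n
      g′ = shanks k (suc n)
      lemma₁ : ∀ k n t → suc k ℕ.* suc n ℕ.+ t ≡ (suc k ℕ.* n ℕ.+ t) ℕ.+ suc k
      lemma₁ = solve-∀
      lemma₂ : ∀ k n t → suc (suc k) ℕ.* n ℕ.+ (t ℕ.+ suc (suc k)) ≡ (suc k ℕ.* n ℕ.+ t) ℕ.+ (suc n ℕ.+ suc k)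
      lemma₂ = solve-∀
      ay : q^ (suc k ℕ.* suc n ℕ.+ tri (suc k)) ≈ (a *ₛ y)
      ay = q^-split (suc k ℕ.* n ℕ.+ tri (suc k)) (suc k) (lemma₁ k n (tri (suc k)))
      axy : q^ (suc (suc k) ℕ.* n ℕ.+ tri (suc (suc k))) ≈ (a *ₛ (x *ₛ y))
      axy = ≈-trans (q^-split (suc k ℕ.* n ℕ.+ tri (suc k)) (suc n ℕ.+ suc k) (lemma₂ k n (tri (suc k))))
        (*-congˡ a (q^-split (suc n) (suc k) refl))

    -- On the diagonal the factor 1 - q^(n+1) created by increasing k is the one that `shanks-suc`
    -- needs to lower n, so nothing has to be divided. The boundary term and the new last summand
    -- supply the two pentagonal terms.
    shanks-diagonal : ∀ n → shanks n n ≈ partialSum n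
    shanks-diagonal zero    = ≈-refl
    shanks-diagonal (suc n) = begin
      (shanks n (suc n) *ₛ (oneₛ ⊕ (⊖ q^ (suc n)))) ⊕ (sgn (suc n) *ₛ b)
        ≈⟨ +-congʳ (sgn (suc n) *ₛ b) (≈-trans (*-comm (shanks n (suc n)) (oneₛ ⊕ (⊖ q^ (suc n)))) (shanks-suc n n)) ⟩
      (shanks n n ⊕ (⊖ (sgn n *ₛ a))) ⊕ (sgn (suc n) *ₛ b)
        ≈⟨ +-congʳ (sgn (suc n) *ₛ b) (+-congʳ (⊖ (sgn n *ₛ a)) (shanks-diagonal n)) ⟩
      (partialSum n ⊕ (⊖ (sgn n *ₛ a))) ⊕ ((⊖ sgn n) *ₛ b)
        ≈⟨ solve 4 (λ s σ a b → (s :+ (:- (σ :* a))) :+ ((:- σ) :* b) := s :+ ((:- σ) :* (a :+ b)))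
             ≈-refl (partialSum n) (sgn n) a b ⟩
      partialSum n ⊕ (sgn (suc n) *ₛ (a ⊕ b)) ∎
      where
      a b : Series
      a = q^ (suc n ℕ.* n ℕ.+ tri (suc n))
      b = q^ (suc n ℕ.* suc n ℕ.+ tri (suc n))

    -- At n = N every summand with s ≥ 1 has exponent above N, so only the summand s = 0 survives.
    shanks-truncated : ∀ k → shanks k N ≈ qPoch 1 1 k
    shanks-truncated zero    = ≈-refl
    shanks-truncated (suc k) = begin
      (shanks k N *ₛ (oneₛ ⊕ (⊖ q^ (suc k)))) ⊕ (sgn (suc k) *ₛ q^ (suc k ℕ.* N ℕ.+ tri (suc k)))
        ≈⟨ +-cong (*-cong (shanks-truncated k) (factor (cong suc (sym (ℕ.*-identityˡ k)))))
             (*-congˡ (sgn (suc k)) (q^-vanishes N<e)) ⟩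
      qPoch 1 1 (suc k) ⊕ (sgn (suc k) *ₛ zeroₛ)
        ≈⟨ solve 2 (λ p s → p :+ (s :* con (+ 0)) := p) ≈-refl (qPoch 1 1 (suc k)) (sgn (suc k)) ⟩
      qPoch 1 1 (suc k) ∎
      where
      N<e : N < suc k ℕ.* N ℕ.+ tri (suc k)
      N<e = ℕ.≤-trans (ℕ.≤-reflexive (ℕ.+-comm 1 N))
        (ℕ.+-mono-≤ (ℕ.m≤m+n N (k ℕ.* N)) (ℕ.≤-trans (s≤s z≤n) (ℕ.m≤n+m (suc k) (tri k))))

    truncated-pentagonal : qPoch 1 1 N ≈ partialSum N
    truncated-pentagonal = ≈-trans (≈-sym (shanks-truncated N)) (shanks-diagonal N)

-- Gauss's two theta series

module _ {a m : ℕ} (1≤a : 1 ≤ a) (1≤m : 1 ≤ m) where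

  module _ {N : ℕ} where
    open Truncated N

    qPoch-stable : ∀ d → qPoch a m (d ℕ.+ N) ≈ qPoch a m N
    qPoch-stable zero    = ≈-refl
    qPoch-stable (suc d) = begin
      qPoch a m (d ℕ.+ N) *ₛ oneMinusQ^ e
        ≈⟨ *-cong (qPoch-stable d) (≈-sym (factor refl)) ⟩
      qPoch a m N *ₛ (oneₛ ⊕ (⊖ q^ e))
        ≈⟨ *-congˡ (qPoch a m N) (+-congˡ oneₛ (-‿cong (q^-vanishes N<e))) ⟩
      qPoch a m N *ₛ (oneₛ ⊕ (⊖ zeroₛ))
        ≈⟨ solve 1 (λ x → x :* (con (+ 1) :+ (:- con (+ 0))) := x) ≈-refl (qPoch a m N) ⟩
      qPoch a m N ∎
      where
      e : ℕ
      e = a ℕ.+ m ℕ.* (d ℕ.+ N)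
      N<e : N < e
      N<e = ℕ.+-mono-≤ 1≤a (ℕ.≤-trans (ℕ.m≤n+m N d) (ℕ.≤-trans (ℕ.≤-reflexive (sym (ℕ.*-identityˡ _))) (ℕ.*-monoˡ-≤ (d ℕ.+ N) 1≤m)))

  -- For coefficient n, both the n + 1 factors of `poch` and the N ≥ n factors of `qPoch` are
  -- compared with n factors; all later factors are 1 + O(q^(n+1)).
  poch-truncated : ∀ {N} → poch a m ≈[ N ] qPoch a m N
  poch-truncated {N} = modulo λ {n} n≤N → trans (coeff (qPoch-stable {n} 1) ℕ.≤-refl)
    (sym (trans (cong (λ k → qPoch a m k n) (sym (ℕ.m∸n+n≡m n≤N))) (coeff (qPoch-stable {n} (N ℕ.∸ n)) ℕ.≤-refl)))

module SquareSum where

  prodPlus : ℕ → Series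
  prodPlus k = ∏< k (λ j → oneₛ ⊕ q^ (suc j))

  -- (q; q)_k + 2 Σ_{1 ≤ s ≤ k} (-1)^s (q; q)_k / (q; q)_s (-q; q)_{s-1} q^{s(n+1)}
  shanks : ℕ → ℕ → Series
  shanks zero    n = oneₛ
  shanks (suc k) n = (shanks k n *ₛ (oneₛ ⊕ (⊖ q^ (suc k)))) ⊕
    ((sgn (suc k) ⊕ sgn (suc k)) *ₛ (prodPlus k *ₛ q^ (suc k ℕ.* suc n)))

  partialSum : ℕ → Series
  partialSum zero    = oneₛ
  partialSum (suc n) = partialSum n ⊕ ((sgn (suc n) ⊕ sgn (suc n)) *ₛ q^ (suc n ℕ.* suc n))

  module _ (N : ℕ) where
    open Truncated N

    -- Telescoping again, with x = q^(n+1) and u_s = 2(-1)^s (q; q)_k / (q; q)_s (-q; q)_s x^(s+1):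
    -- (1 - x) times the s-th summand at n + 1, minus (1 + x) times the one at n, is u_(s-1) - u_s
    -- for s ≥ 1 and -u_0 for s = 0.
    shanks-suc : ∀ k n → ((oneₛ ⊕ (⊖ q^ (suc n))) *ₛ shanks k (suc n)) ≈
                         (((oneₛ ⊕ q^ (suc n)) *ₛ shanks k n) ⊕
                           (⊖ ((sgn k ⊕ sgn k) *ₛ (prodPlus k *ₛ q^ (suc k ℕ.* suc n)))))
    shanks-suc zero    n = begin
      (oneₛ ⊕ (⊖ q^ (suc n))) *ₛ oneₛ
        ≈⟨ solve 1 (λ x → (con (+ 1) :+ (:- x)) :* con (+ 1) :=
             ((con (+ 1) :+ x) :* con (+ 1)) :+ (:- ((con (+ 1) :+ con (+ 1)) :* (con (+ 1) :* x)))) ≈-refl (q^ (suc n)) ⟩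
      ((oneₛ ⊕ q^ (suc n)) *ₛ oneₛ) ⊕ (⊖ ((oneₛ ⊕ oneₛ) *ₛ (oneₛ *ₛ q^ (suc n))))
        ≡⟨ cong (λ e → ((oneₛ ⊕ q^ (suc n)) *ₛ oneₛ) ⊕ (⊖ ((oneₛ ⊕ oneₛ) *ₛ (oneₛ *ₛ q^ e)))) (ℕ.*-identityˡ (suc n)) ⟨
      ((oneₛ ⊕ q^ (suc n)) *ₛ oneₛ) ⊕ (⊖ ((oneₛ ⊕ oneₛ) *ₛ (oneₛ *ₛ q^ (1 ℕ.* suc n)))) ∎
    shanks-suc (suc k) n = begin
      (oneₛ ⊕ (⊖ x)) *ₛ ((h′ *ₛ (oneₛ ⊕ (⊖ y))) ⊕ (((⊖ σ) ⊕ (⊖ σ)) *ₛ (M *ₛ q^ (suc k ℕ.* suc (suc n)))))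
        ≈⟨ *-congˡ (oneₛ ⊕ (⊖ x)) (+-congˡ (h′ *ₛ (oneₛ ⊕ (⊖ y))) (*-congˡ ((⊖ σ) ⊕ (⊖ σ)) (*-congˡ M
             (q^-split (suc k ℕ.* suc n) (suc k) (lemma₁ k n))))) ⟩
      (oneₛ ⊕ (⊖ x)) *ₛ ((h′ *ₛ (oneₛ ⊕ (⊖ y))) ⊕ (((⊖ σ) ⊕ (⊖ σ)) *ₛ (M *ₛ (a *ₛ y))))
        ≈⟨ solve 6 (λ x y σ a h′ M →
             (con (+ 1) :+ (:- x)) :* ((h′ :* (con (+ 1) :+ (:- y))) :+ (((:- σ) :+ (:- σ)) :* (M :* (a :* y)))) :=
             (((con (+ 1) :+ (:- x)) :* h′) :* (con (+ 1) :+ (:- y))) :+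
               ((con (+ 1) :+ (:- x)) :* (((:- σ) :+ (:- σ)) :* (M :* (a :* y)))))
             ≈-refl x y σ a h′ M ⟩
      (((oneₛ ⊕ (⊖ x)) *ₛ h′) *ₛ (oneₛ ⊕ (⊖ y))) ⊕ ((oneₛ ⊕ (⊖ x)) *ₛ (((⊖ σ) ⊕ (⊖ σ)) *ₛ (M *ₛ (a *ₛ y))))
        ≈⟨ +-congʳ ((oneₛ ⊕ (⊖ x)) *ₛ (((⊖ σ) ⊕ (⊖ σ)) *ₛ (M *ₛ (a *ₛ y)))) (*-congʳ (oneₛ ⊕ (⊖ y)) (shanks-suc k n)) ⟩
      ((((oneₛ ⊕ x) *ₛ h) ⊕ (⊖ ((σ ⊕ σ) *ₛ (M *ₛ a)))) *ₛ (oneₛ ⊕ (⊖ y))) ⊕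
          ((oneₛ ⊕ (⊖ x)) *ₛ (((⊖ σ) ⊕ (⊖ σ)) *ₛ (M *ₛ (a *ₛ y))))
        ≈⟨ solve 6 (λ x y σ a h M →
             ((((con (+ 1) :+ x) :* h) :+ (:- ((σ :+ σ) :* (M :* a)))) :* (con (+ 1) :+ (:- y))) :+
               ((con (+ 1) :+ (:- x)) :* (((:- σ) :+ (:- σ)) :* (M :* (a :* y)))) :=
             ((con (+ 1) :+ x) :* ((h :* (con (+ 1) :+ (:- y))) :+ (((:- σ) :+ (:- σ)) :* (M :* a)))) :+
               (:- (((:- σ) :+ (:- σ)) :* ((M :* (con (+ 1) :+ y)) :* (a :* x)))))
             ≈-refl x y σ a h M ⟩
      ((oneₛ ⊕ x) *ₛ ((h *ₛ (oneₛ ⊕ (⊖ y))) ⊕ (((⊖ σ) ⊕ (⊖ σ)) *ₛ (M *ₛ a)))) ⊕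
          (⊖ (((⊖ σ) ⊕ (⊖ σ)) *ₛ ((M *ₛ (oneₛ ⊕ y)) *ₛ (a *ₛ x))))
        ≈⟨ +-congˡ ((oneₛ ⊕ x) *ₛ ((h *ₛ (oneₛ ⊕ (⊖ y))) ⊕ (((⊖ σ) ⊕ (⊖ σ)) *ₛ (M *ₛ a))))
             (-‿cong (*-congˡ ((⊖ σ) ⊕ (⊖ σ)) (*-congˡ (M *ₛ (oneₛ ⊕ y))
               (q^-split (suc k ℕ.* suc n) (suc n) (ℕ.+-comm (suc n) (suc k ℕ.* suc n)))))) ⟨
      ((oneₛ ⊕ x) *ₛ ((h *ₛ (oneₛ ⊕ (⊖ y))) ⊕ (((⊖ σ) ⊕ (⊖ σ)) *ₛ (M *ₛ a)))) ⊕
          (⊖ (((⊖ σ) ⊕ (⊖ σ)) *ₛ ((M *ₛ (oneₛ ⊕ y)) *ₛ q^ (suc (suc k) ℕ.* suc n)))) ∎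
      where
      x y σ a h h′ M : Series
      x = q^ (suc n)
      y = q^ (suc k)
      σ = sgn k
      a = q^ (suc k ℕ.* suc n)
      h = shanks k n
      h′ = shanks k (suc n)
      M = prodPlus k
      lemma₁ : ∀ k n → suc k ℕ.* suc (suc n) ≡ (suc k ℕ.* suc n) ℕ.+ suc k
      lemma₁ = solve-∀

    -- The boundary term and the new last summand differ by the factor x = q^(n+1). Together they
    -- acquire 1 + x, which completes (-q; q)_(n+1) in front of the new square term.
    shanks-diagonal : ∀ n → shanks n n ≈ (prodPlus n *ₛ partialSum n)
    shanks-diagonal zero    = solve 0 (con (+ 1) := con (+ 1) :* con (+ 1)) ≈-refl
    shanks-diagonal (suc n) = begin
      (shanks n (suc n) *ₛ (oneₛ ⊕ (⊖ x))) ⊕ t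
        ≈⟨ +-congʳ t (≈-trans (*-comm (shanks n (suc n)) (oneₛ ⊕ (⊖ x))) (shanks-suc n n)) ⟩
      (((oneₛ ⊕ x) *ₛ shanks n n) ⊕ (⊖ ((σ ⊕ σ) *ₛ (M *ₛ a)))) ⊕ t
        ≈⟨ +-cong (+-congʳ (⊖ ((σ ⊕ σ) *ₛ (M *ₛ a))) (*-congˡ (oneₛ ⊕ x) (shanks-diagonal n)))
             (*-congˡ ((⊖ σ) ⊕ (⊖ σ)) (*-congˡ M (q^-split (suc n ℕ.* suc n) (suc n) (lemma n)))) ⟩
      (((oneₛ ⊕ x) *ₛ (M *ₛ S)) ⊕ (⊖ ((σ ⊕ σ) *ₛ (M *ₛ a)))) ⊕ (((⊖ σ) ⊕ (⊖ σ)) *ₛ (M *ₛ (a *ₛ x)))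
        ≈⟨ solve 5 (λ x σ a M S →
             (((con (+ 1) :+ x) :* (M :* S)) :+ (:- ((σ :+ σ) :* (M :* a)))) :+ (((:- σ) :+ (:- σ)) :* (M :* (a :* x))) :=
             (M :* (con (+ 1) :+ x)) :* (S :+ (((:- σ) :+ (:- σ)) :* a))) ≈-refl x σ a M S ⟩
      (M *ₛ (oneₛ ⊕ x)) *ₛ (S ⊕ (((⊖ σ) ⊕ (⊖ σ)) *ₛ a)) ∎
      where
      x σ a M S t : Series
      x = q^ (suc n)
      σ = sgn n
      a = q^ (suc n ℕ.* suc n)
      M = prodPlus n
      S = partialSum n
      t = (sgn (suc n) ⊕ sgn (suc n)) *ₛ (prodPlus n *ₛ q^ (suc n ℕ.* suc (suc n)))
      lemma : ∀ n → suc n ℕ.* suc (suc n) ≡ (suc n ℕ.* suc n) ℕ.+ suc n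
      lemma = solve-∀

    shanks-truncated : ∀ k → shanks k N ≈ qPoch 1 1 k
    shanks-truncated zero    = ≈-refl
    shanks-truncated (suc k) = begin
      (shanks k N *ₛ (oneₛ ⊕ (⊖ q^ (suc k)))) ⊕ (τ *ₛ (prodPlus k *ₛ q^ (suc k ℕ.* suc N)))
        ≈⟨ +-cong (*-cong (shanks-truncated k) (factor (cong suc (sym (ℕ.*-identityˡ k)))))
             (*-congˡ τ (*-congˡ (prodPlus k) (q^-vanishes (ℕ.m≤m+n (suc N) (k ℕ.* suc N))))) ⟩
      qPoch 1 1 (suc k) ⊕ (τ *ₛ (prodPlus k *ₛ zeroₛ))
        ≈⟨ solve 3 (λ p s t → p :+ (s :* (t :* con (+ 0))) := p) ≈-refl (qPoch 1 1 (suc k)) τ (prodPlus k) ⟩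
      qPoch 1 1 (suc k) ∎
      where
      τ : Series
      τ = sgn (suc k) ⊕ sgn (suc k)

    prodPlus-qPoch : ∀ k → (prodPlus k *ₛ qPoch 1 1 k) ≈ qPoch 2 2 k
    prodPlus-qPoch zero    = solve 0 (con (+ 1) :* con (+ 1) := con (+ 1)) ≈-refl
    prodPlus-qPoch (suc k) = begin
      (M *ₛ (oneₛ ⊕ x)) *ₛ (P *ₛ oneMinusQ^ (1 ℕ.+ 1 ℕ.* k))
        ≈⟨ *-congˡ (M *ₛ (oneₛ ⊕ x)) (*-congˡ P (factor (cong suc (sym (ℕ.*-identityˡ k))))) ⟨
      (M *ₛ (oneₛ ⊕ x)) *ₛ (P *ₛ (oneₛ ⊕ (⊖ x)))
        ≈⟨ solve 3 (λ x M P → (M :* (con (+ 1) :+ x)) :* (P :* (con (+ 1) :+ (:- x))) :=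
             (M :* P) :* (con (+ 1) :+ (:- (x :* x)))) ≈-refl x M P ⟩
      (M *ₛ P) *ₛ (oneₛ ⊕ (⊖ (x *ₛ x)))
        ≈⟨ *-cong (prodPlus-qPoch k) (≈-trans (+-congˡ oneₛ (-‿cong (≈-sym (q^-split (suc k) (suc k) refl)))) (factor (lemma k))) ⟩
      qPoch 2 2 k *ₛ oneMinusQ^ (2 ℕ.+ 2 ℕ.* k) ∎
      where
      x M P : Series
      x = q^ (suc k)
      M = prodPlus k
      P = qPoch 1 1 k
      lemma : ∀ k → suc k ℕ.+ suc k ≡ 2 ℕ.+ 2 ℕ.* k
      lemma = solve-∀

    -- The diagonal gives (-q; q)_N S = (q; q)_N modulo q^(N+1). Multiplying by (q; q)_N turns the
    -- left factor into (q²; q²)_N, which is the cross-multiplied form of E(q)²/E(q²).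
    truncated-gauss : (partialSum N *ₛ poch 2 2) ≈ (poch 1 1 *ₛ poch 1 1)
    truncated-gauss = begin
      S *ₛ poch 2 2
        ≈⟨ *-congˡ S (≈-trans (poch-truncated {2} {2} (s≤s z≤n) (s≤s z≤n)) (≈-sym (prodPlus-qPoch N))) ⟩
      S *ₛ (prodPlus N *ₛ P)
        ≈⟨ solve 3 (λ s m p → s :* (m :* p) := (m :* s) :* p) ≈-refl S (prodPlus N) P ⟩
      (prodPlus N *ₛ S) *ₛ P
        ≈⟨ *-cong (≈-trans (≈-trans (≈-sym (shanks-diagonal N)) (shanks-truncated N)) E₁) E₁ ⟩
      poch 1 1 *ₛ poch 1 1 ∎
      where
      S P : Series
      S = partialSum N
      P = qPoch 1 1 N
      E₁ : P ≈ poch 1 1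
      E₁ = ≈-sym (poch-truncated {1} {1} (s≤s z≤n) (s≤s z≤n))

module TriangularSum where

  -- Σ_{s ≤ k} (q²; q²)_k / (q²; q²)_s (q; q²)_s q^{s(2n+1)}
  shanks : ℕ → ℕ → Series
  shanks zero    n = oneₛ
  shanks (suc k) n = (shanks k n *ₛ (oneₛ ⊕ (⊖ q^ (2 ℕ.+ 2 ℕ.* k)))) ⊕
    (qPoch 1 2 (suc k) *ₛ q^ (suc k ℕ.* (1 ℕ.+ 2 ℕ.* n)))

  -- The exponents are the consecutive triangular numbers `tri (2n + 1)` and `tri (2n + 2)`.
  partialSum : ℕ → Series
  partialSum zero    = oneₛ
  partialSum (suc n) = partialSum n ⊕
    (q^ (suc n ℕ.* (1 ℕ.+ 2 ℕ.* n)) ⊕ q^ (suc n ℕ.* (1 ℕ.+ 2 ℕ.* suc n)))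

  module _ (N : ℕ) where
    open Truncated N

    -- With z = q^(2n+1) and u_s = (q²; q²)_k / (q²; q²)_s (q; q²)_(s+1) z^(s+1), the difference of
    -- the two weighted s-th summands is u_s - u_(s-1), again without u_(s-1) for s = 0. Only u_k
    -- remains.
    shanks-suc : ∀ k n → ((oneₛ ⊕ (⊖ q^ (2 ℕ.+ 2 ℕ.* n))) *ₛ shanks k (suc n)) ≈
                         (((oneₛ ⊕ (⊖ q^ (1 ℕ.+ 2 ℕ.* n))) *ₛ shanks k n) ⊕
                           (qPoch 1 2 (suc k) *ₛ q^ (suc k ℕ.* (1 ℕ.+ 2 ℕ.* n))))
    shanks-suc zero    n = begin
      (oneₛ ⊕ (⊖ q^ (2 ℕ.+ 2 ℕ.* n))) *ₛ oneₛ
        ≈⟨ *-congʳ oneₛ (+-congˡ oneₛ (-‿cong (q^-split 1 (1 ℕ.+ 2 ℕ.* n) refl))) ⟩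
      (oneₛ ⊕ (⊖ (q^ 1 *ₛ z))) *ₛ oneₛ
        ≈⟨ solve 2 (λ q z → (con (+ 1) :+ (:- (q :* z))) :* con (+ 1) :=
             ((con (+ 1) :+ (:- z)) :* con (+ 1)) :+ ((con (+ 1) :* (con (+ 1) :+ (:- q))) :* z)) ≈-refl (q^ 1) z ⟩
      ((oneₛ ⊕ (⊖ z)) *ₛ oneₛ) ⊕ ((oneₛ *ₛ (oneₛ ⊕ (⊖ q^ 1))) *ₛ z)
        ≈⟨ +-congˡ ((oneₛ ⊕ (⊖ z)) *ₛ oneₛ) (*-cong (*-congˡ oneₛ (factor refl))
             (reflexive (cong q^ (sym (ℕ.*-identityˡ (1 ℕ.+ 2 ℕ.* n)))))) ⟩
      ((oneₛ ⊕ (⊖ z)) *ₛ oneₛ) ⊕ ((oneₛ *ₛ oneMinusQ^ 1) *ₛ q^ (1 ℕ.* (1 ℕ.+ 2 ℕ.* n))) ∎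
      where
      z : Series
      z = q^ (1 ℕ.+ 2 ℕ.* n)
    shanks-suc (suc k) n = begin
      (oneₛ ⊕ (⊖ q^ (2 ℕ.+ 2 ℕ.* n))) *ₛ ((h′ *ₛ (oneₛ ⊕ (⊖ y))) ⊕ (O *ₛ q^ (suc k ℕ.* (1 ℕ.+ 2 ℕ.* suc n))))
        ≈⟨ *-cong (+-congˡ oneₛ (-‿cong x-split)) (+-congˡ (h′ *ₛ (oneₛ ⊕ (⊖ y))) (*-congˡ O
             (q^-split (suc k ℕ.* (1 ℕ.+ 2 ℕ.* n)) (2 ℕ.+ 2 ℕ.* k) (lemma₁ k n)))) ⟩
      (oneₛ ⊕ (⊖ (q^ 1 *ₛ z))) *ₛ ((h′ *ₛ (oneₛ ⊕ (⊖ y))) ⊕ (O *ₛ (a *ₛ y)))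
        ≈⟨ solve 6 (λ q z y O a h′ →
             (con (+ 1) :+ (:- (q :* z))) :* ((h′ :* (con (+ 1) :+ (:- y))) :+ (O :* (a :* y))) :=
             (((con (+ 1) :+ (:- (q :* z))) :* h′) :* (con (+ 1) :+ (:- y))) :+
               ((con (+ 1) :+ (:- (q :* z))) :* (O :* (a :* y))))
             ≈-refl (q^ 1) z y O a h′ ⟩
      (((oneₛ ⊕ (⊖ (q^ 1 *ₛ z))) *ₛ h′) *ₛ (oneₛ ⊕ (⊖ y))) ⊕ ((oneₛ ⊕ (⊖ (q^ 1 *ₛ z))) *ₛ (O *ₛ (a *ₛ y)))
        ≈⟨ +-congʳ ((oneₛ ⊕ (⊖ (q^ 1 *ₛ z))) *ₛ (O *ₛ (a *ₛ y))) (*-congʳ (oneₛ ⊕ (⊖ y))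
             (≈-trans (*-congʳ h′ (+-congˡ oneₛ (-‿cong (≈-sym x-split)))) (shanks-suc k n))) ⟩
      ((((oneₛ ⊕ (⊖ z)) *ₛ h) ⊕ (O *ₛ a)) *ₛ (oneₛ ⊕ (⊖ y))) ⊕ ((oneₛ ⊕ (⊖ (q^ 1 *ₛ z))) *ₛ (O *ₛ (a *ₛ y)))
        ≈⟨ solve 6 (λ q z y O a h →
             ((((con (+ 1) :+ (:- z)) :* h) :+ (O :* a)) :* (con (+ 1) :+ (:- y))) :+
               ((con (+ 1) :+ (:- (q :* z))) :* (O :* (a :* y))) :=
             ((con (+ 1) :+ (:- z)) :* ((h :* (con (+ 1) :+ (:- y))) :+ (O :* a))) :+
               ((O :* (con (+ 1) :+ (:- (q :* y)))) :* (a :* z)))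
             ≈-refl (q^ 1) z y O a h ⟩
      ((oneₛ ⊕ (⊖ z)) *ₛ ((h *ₛ (oneₛ ⊕ (⊖ y))) ⊕ (O *ₛ a))) ⊕ ((O *ₛ (oneₛ ⊕ (⊖ (q^ 1 *ₛ y)))) *ₛ (a *ₛ z))
        ≈⟨ +-congˡ ((oneₛ ⊕ (⊖ z)) *ₛ ((h *ₛ (oneₛ ⊕ (⊖ y))) ⊕ (O *ₛ a)))
             (*-cong (*-congˡ O w-split) (≈-sym (q^-split (suc k ℕ.* (1 ℕ.+ 2 ℕ.* n)) (1 ℕ.+ 2 ℕ.* n)
               (ℕ.+-comm (1 ℕ.+ 2 ℕ.* n) (suc k ℕ.* (1 ℕ.+ 2 ℕ.* n)))))) ⟩
      ((oneₛ ⊕ (⊖ z)) *ₛ ((h *ₛ (oneₛ ⊕ (⊖ y))) ⊕ (O *ₛ a))) ⊕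
          ((O *ₛ oneMinusQ^ (1 ℕ.+ 2 ℕ.* suc k)) *ₛ q^ (suc (suc k) ℕ.* (1 ℕ.+ 2 ℕ.* n))) ∎
      where
      z y O a h h′ : Series
      z = q^ (1 ℕ.+ 2 ℕ.* n)
      y = q^ (2 ℕ.+ 2 ℕ.* k)
      O = qPoch 1 2 (suc k)
      a = q^ (suc k ℕ.* (1 ℕ.+ 2 ℕ.* n))
      h = shanks k n
      h′ = shanks k (suc n)
      lemma₁ : ∀ k n → suc k ℕ.* (1 ℕ.+ 2 ℕ.* suc n) ≡ suc k ℕ.* (1 ℕ.+ 2 ℕ.* n) ℕ.+ (2 ℕ.+ 2 ℕ.* k)
      lemma₁ = solve-∀
      lemma₂ : ∀ k → 1 ℕ.+ (2 ℕ.+ 2 ℕ.* k) ≡ 1 ℕ.+ 2 ℕ.* suc k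
      lemma₂ = solve-∀
      x-split : q^ (2 ℕ.+ 2 ℕ.* n) ≈ (q^ 1 *ₛ z)
      x-split = q^-split 1 (1 ℕ.+ 2 ℕ.* n) refl
      w-split : (oneₛ ⊕ (⊖ (q^ 1 *ₛ y))) ≈ oneMinusQ^ (1 ℕ.+ 2 ℕ.* suc k)
      w-split = ≈-trans (+-congˡ oneₛ (-‿cong (≈-sym (q^-split 1 (2 ℕ.+ 2 ℕ.* k) refl)))) (factor (lemma₂ k))

    shanks-diagonal : ∀ n → shanks n n ≈ (qPoch 1 2 n *ₛ partialSum n)
    shanks-diagonal zero    = solve 0 (con (+ 1) := con (+ 1) :* con (+ 1)) ≈-refl
    shanks-diagonal (suc n) = begin
      (shanks n (suc n) *ₛ (oneₛ ⊕ (⊖ x))) ⊕ (O′ *ₛ b)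
        ≈⟨ +-congʳ (O′ *ₛ b) (≈-trans (*-comm (shanks n (suc n)) (oneₛ ⊕ (⊖ x))) (shanks-suc n n)) ⟩
      (((oneₛ ⊕ (⊖ z)) *ₛ shanks n n) ⊕ (O′ *ₛ a)) ⊕ (O′ *ₛ b)
        ≈⟨ +-congʳ (O′ *ₛ b) (+-congʳ (O′ *ₛ a) (*-cong (factor refl) (shanks-diagonal n))) ⟩
      ((oneMinusQ^ (1 ℕ.+ 2 ℕ.* n) *ₛ (qPoch 1 2 n *ₛ S)) ⊕ (O′ *ₛ a)) ⊕ (O′ *ₛ b)
        ≈⟨ solve 5 (λ f O S a b → ((f :* (O :* S)) :+ ((O :* f) :* a)) :+ ((O :* f) :* b) :=
             (O :* f) :* (S :+ (a :+ b))) ≈-refl (oneMinusQ^ (1 ℕ.+ 2 ℕ.* n)) (qPoch 1 2 n) S a b ⟩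
      O′ *ₛ (S ⊕ (a ⊕ b)) ∎
      where
      x z O′ S a b : Series
      x = q^ (2 ℕ.+ 2 ℕ.* n)
      z = q^ (1 ℕ.+ 2 ℕ.* n)
      O′ = qPoch 1 2 (suc n)
      S = partialSum n
      a = q^ (suc n ℕ.* (1 ℕ.+ 2 ℕ.* n))
      b = q^ (suc n ℕ.* (1 ℕ.+ 2 ℕ.* suc n))

    shanks-truncated : ∀ k → shanks k N ≈ qPoch 2 2 k
    shanks-truncated zero    = ≈-refl
    shanks-truncated (suc k) = begin
      (shanks k N *ₛ (oneₛ ⊕ (⊖ q^ (2 ℕ.+ 2 ℕ.* k)))) ⊕ (O *ₛ q^ (suc k ℕ.* (1 ℕ.+ 2 ℕ.* N)))
        ≈⟨ +-cong (*-cong (shanks-truncated k) (factor refl)) (*-congˡ O (q^-vanishes N<e)) ⟩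
      qPoch 2 2 (suc k) ⊕ (O *ₛ zeroₛ)
        ≈⟨ solve 2 (λ p s → p :+ (s :* con (+ 0)) := p) ≈-refl (qPoch 2 2 (suc k)) O ⟩
      qPoch 2 2 (suc k) ∎
      where
      O : Series
      O = qPoch 1 2 (suc k)
      N<e : N < suc k ℕ.* (1 ℕ.+ 2 ℕ.* N)
      N<e = ℕ.≤-trans (s≤s (ℕ.m≤m+n N (1 ℕ.* N))) (ℕ.m≤m+n (1 ℕ.+ 2 ℕ.* N) (k ℕ.* (1 ℕ.+ 2 ℕ.* N)))

    qPoch-odd-even : ∀ k → (qPoch 1 2 k *ₛ qPoch 2 2 k) ≈ qPoch 1 1 (k ℕ.+ k)
    qPoch-odd-even zero    = solve 0 (con (+ 1) :* con (+ 1) := con (+ 1)) ≈-refl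
    qPoch-odd-even (suc k) = begin
      (O *ₛ oneMinusQ^ (1 ℕ.+ 2 ℕ.* k)) *ₛ (E *ₛ oneMinusQ^ (2 ℕ.+ 2 ℕ.* k))
        ≈⟨ solve 4 (λ O e E f → (O :* e) :* (E :* f) := ((O :* E) :* e) :* f) ≈-refl
             O (oneMinusQ^ (1 ℕ.+ 2 ℕ.* k)) E (oneMinusQ^ (2 ℕ.+ 2 ℕ.* k)) ⟩
      ((O *ₛ E) *ₛ oneMinusQ^ (1 ℕ.+ 2 ℕ.* k)) *ₛ oneMinusQ^ (2 ℕ.+ 2 ℕ.* k)
        ≈⟨ *-cong (*-cong (qPoch-odd-even k) (reflexive (cong oneMinusQ^ (lemma₁ k)))) (reflexive (cong oneMinusQ^ (lemma₂ k))) ⟩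
      qPoch 1 1 (suc (suc (k ℕ.+ k)))
        ≡⟨ cong (λ i → qPoch 1 1 (suc i)) (ℕ.+-suc k k) ⟨
      qPoch 1 1 (suc k ℕ.+ suc k) ∎
      where
      O E : Series
      O = qPoch 1 2 k
      E = qPoch 2 2 k
      lemma₁ : ∀ k → 1 ℕ.+ 2 ℕ.* k ≡ 1 ℕ.+ 1 ℕ.* (k ℕ.+ k)
      lemma₁ = solve-∀
      lemma₂ : ∀ k → 2 ℕ.+ 2 ℕ.* k ≡ 1 ℕ.+ 1 ℕ.* suc (k ℕ.+ k)
      lemma₂ = solve-∀

    truncated-gauss : (partialSum N *ₛ poch 1 1) ≈ (poch 2 2 *ₛ poch 2 2)
    truncated-gauss = begin
      S *ₛ poch 1 1
        -- N odd and N even exponents make 2N factors, so (q; q)_∞ is first truncated at N + N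
        -- instead of N.
        ≈⟨ *-congˡ S (≈-trans (≈-trans (poch-truncated {1} {1} (s≤s z≤n) (s≤s z≤n))
             (≈-sym (qPoch-stable {1} {1} (s≤s z≤n) (s≤s z≤n) N))) (≈-sym (qPoch-odd-even N))) ⟩
      S *ₛ (qPoch 1 2 N *ₛ E)
        ≈⟨ solve 3 (λ s m p → s :* (m :* p) := (m :* s) :* p) ≈-refl S (qPoch 1 2 N) E ⟩
      (qPoch 1 2 N *ₛ S) *ₛ E
        ≈⟨ *-cong (≈-trans (≈-trans (≈-sym (shanks-diagonal N)) (shanks-truncated N)) E₂) E₂ ⟩
      poch 2 2 *ₛ poch 2 2 ∎
      where
      S E : Series
      S = partialSum N
      E = qPoch 2 2 N
      E₂ : E ≈ poch 2 2
      E₂ = ≈-sym (poch-truncated {2} {2} (s≤s z≤n) (s≤s z≤n))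

-- Dissections and infinite products

Σ<-single : ∀ {n f k} → k < n → (∀ {i} → i ≢ k → f i ≡ + 0) → Σ< n f ≡ f k
Σ<-single {suc n} {f} {k} k<1+n f≡0 with k ℕ.≟ n
... | yes refl = trans (cong (ℤ._+ f n) (Σ<-zero n λ i<n → f≡0 (ℕ.<⇒≢ i<n))) (ℤ.+-identityˡ (f n))
... | no  k≢n  = trans (cong₂ ℤ._+_ (Σ<-single {n} (ℕ.≤∧≢⇒< (ℕ.≤-pred k<1+n) k≢n) f≡0) (f≡0 λ n≡k → k≢n (sym n≡k)))
  (ℤ.+-identityʳ (f k))

module Dilation (p : ℕ) .{{p≢0 : NonZero p}} where

  -- The substitution of q^p for q.
  dilate : Series → Series
  dilate f n with p ∣? n
  ... | yes (divides k _) = f k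
  ... | no  _             = + 0

  dilate-* : ∀ f k → dilate f (k ℕ.* p) ≡ f k
  dilate-* f k with p ∣? (k ℕ.* p)
  ... | yes (divides l k*p≡l*p) = cong f (sym (ℕ.*-cancelʳ-≡ k l p k*p≡l*p))
  ... | no  p∤k*p               = ⊥-elim (p∤k*p (n∣m*n k))

  dilate-∤ : ∀ f {n} → ¬ p ∣ n → dilate f n ≡ + 0
  dilate-∤ f {n} p∤n with p ∣? n
  ... | yes p∣n = ⊥-elim (p∤n p∣n)
  ... | no  _   = refl

  m*p+r∤ : ∀ m {r} → suc r < p → ¬ p ∣ (m ℕ.* p ℕ.+ suc r)
  m*p+r∤ m 1+r<p p∣ = >⇒∤ 1+r<p (∣m+n∣m⇒∣n p∣ (n∣m*n m))

  -- Any b < p is allowed, so that the incomplete last block of a Cauchy product is covered as well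
  -- as full blocks.
  Σ<-multiples-block : ∀ m {b} {F : ℕ → ℤ} → (∀ {n} → ¬ p ∣ n → F n ≡ + 0) → b < p →
                       Σ< (suc b) (λ i → F (m ℕ.* p ℕ.+ i)) ≡ F (m ℕ.* p)
  Σ<-multiples-block m {zero}  {F} F≡0 b<p = trans (ℤ.+-identityˡ _) (cong F (ℕ.+-identityʳ (m ℕ.* p)))
  Σ<-multiples-block m {suc b} {F} F≡0 b<p = trans
    (cong₂ ℤ._+_ (Σ<-multiples-block m F≡0 (ℕ.<-trans (ℕ.n<1+n b) b<p)) (F≡0 (m*p+r∤ m b<p)))
    (ℤ.+-identityʳ (F (m ℕ.* p)))

  Σ<-multiples : ∀ m {F : ℕ → ℤ} → (∀ {n} → ¬ p ∣ n → F n ≡ + 0) →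
                 Σ< (m ℕ.* p) F ≡ Σ< m (λ j → F (j ℕ.* p))
  Σ<-multiples zero    F≡0 = refl
  Σ<-multiples (suc m) {F} F≡0 = begin
    Σ< (p ℕ.+ m ℕ.* p) F
      ≡⟨ cong (λ i → Σ< i F) (ℕ.+-comm p (m ℕ.* p)) ⟩
    Σ< (m ℕ.* p ℕ.+ p) F
      ≡⟨ Σ<-++ (m ℕ.* p) p F ⟩
    Σ< (m ℕ.* p) F ℤ.+ Σ< p (λ i → F (m ℕ.* p ℕ.+ i))
      ≡⟨ cong (λ i → Σ< (m ℕ.* p) F ℤ.+ Σ< i (λ i → F (m ℕ.* p ℕ.+ i))) (ℕ.suc-pred p) ⟨
    Σ< (m ℕ.* p) F ℤ.+ Σ< (suc (ℕ.pred p)) (λ i → F (m ℕ.* p ℕ.+ i))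
      ≡⟨ cong₂ ℤ._+_ (Σ<-multiples m F≡0) (Σ<-multiples-block m F≡0 (ℕ.≤-reflexive (ℕ.suc-pred p))) ⟩
    Σ< m (λ j → F (j ℕ.* p)) ℤ.+ F (m ℕ.* p) ∎
    where open ≡-Reasoning

  section : ℕ → Series → Series
  section r f n = f (n ℕ.* p ℕ.+ r)

  -- A series in q^p has only exponents divisible by p, so multiplying by it preserves residue
  -- classes, and it can be pulled out of a section as f(q).
  dilate-*ₛ-section : ∀ f h {r} → r < p → section r (dilate f *ₛ h) ≈ₛ (f *ₛ section r h)
  dilate-*ₛ-section f h {r} r<p n = begin
    Σ< (suc (n ℕ.* p ℕ.+ r)) F
      ≡⟨ cong (λ i → Σ< i F) (ℕ.+-suc (n ℕ.* p) r) ⟨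
    Σ< (n ℕ.* p ℕ.+ suc r) F
      ≡⟨ Σ<-++ (n ℕ.* p) (suc r) F ⟩
    Σ< (n ℕ.* p) F ℤ.+ Σ< (suc r) (λ i → F (n ℕ.* p ℕ.+ i))
      ≡⟨ cong₂ ℤ._+_ (Σ<-multiples n F≡0) (Σ<-multiples-block n F≡0 r<p) ⟩
    Σ< (suc n) (λ j → F (j ℕ.* p))
      ≡⟨ Σ<-cong (suc n) (λ {j} j<1+n → cong₂ ℤ._*_ (dilate-* f j) (cong h (index (ℕ.≤-pred j<1+n)))) ⟩
    (f *ₛ section r h) n ∎
    where
    open ≡-Reasoning
    F : ℕ → ℤ
    F k = dilate f k ℤ.* h (n ℕ.* p ℕ.+ r ℕ.∸ k)
    F≡0 : ∀ {k} → ¬ p ∣ k → F k ≡ + 0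
    F≡0 {k} p∤k = cong (ℤ._* h (n ℕ.* p ℕ.+ r ℕ.∸ k)) (dilate-∤ f p∤k)
    index : ∀ {j} → j ≤ n → n ℕ.* p ℕ.+ r ℕ.∸ j ℕ.* p ≡ (n ℕ.∸ j) ℕ.* p ℕ.+ r
    index {j} j≤n = trans (ℕ.+-∸-comm r (ℕ.*-monoˡ-≤ p j≤n)) (cong (ℕ._+ r) (sym (ℕ.*-distribʳ-∸ p n j)))

  sections-≈ₛ : ∀ {f g} → (∀ {r} → r < p → section r f ≈ₛ section r g) → f ≈ₛ g
  sections-≈ₛ {f} {g} eq n = subst (λ k → f k ≡ g k)
    (trans (ℕ.+-comm ((n ℕ./ p) ℕ.* p) (n ℕ.% p)) (sym (m≡m%n+[m/n]*n n p)))
    (eq (m%n<n n p) (n ℕ./ p))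

  section-dilate-zero : ∀ f → section 0 (dilate f) ≈ₛ f
  section-dilate-zero f n = trans (cong (dilate f) (ℕ.+-identityʳ (n ℕ.* p))) (dilate-* f n)

  section-dilate-suc : ∀ f {r} → suc r < p → section (suc r) (dilate f) ≈ₛ zeroₛ
  section-dilate-suc f r<p n = dilate-∤ f (m*p+r∤ n r<p)

  -- Compared one residue class at a time: class 0 gives the product of f and g on both sides, and
  -- every other class is zero.
  dilate-*ₛ : ∀ f g → dilate (f *ₛ g) ≈ₛ (dilate f *ₛ dilate g)
  dilate-*ₛ f g = sections-≈ₛ sections
    where
    sections : ∀ {r} → r < p → section r (dilate (f *ₛ g)) ≈ₛ section r (dilate f *ₛ dilate g)
    sections {zero}  r<p n = trans (section-dilate-zero (f *ₛ g) n)
      (sym (trans (dilate-*ₛ-section f (dilate g) r<p n) (*ₛ-cong {f} (λ _ → refl) (section-dilate-zero g) n)))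
    sections {suc r} r<p n = trans (section-dilate-suc (f *ₛ g) r<p n)
      (sym (trans (dilate-*ₛ-section f (dilate g) r<p n)
        (Σ<-zero (suc n) λ {k} _ → trans (cong (f k ℤ.*_) (section-dilate-suc g r<p (n ℕ.∸ k))) (ℤ.*-zeroʳ (f k)))))

  dilate-cong : ∀ {N f g} → f ≈[ N ] g → dilate f ≈[ N ] dilate g
  dilate-cong {N} {f} {g} f≈g = modulo lemma
    where
    lemma : ∀ {n} → n ≤ N → dilate f n ≡ dilate g n
    lemma {n} n≤N with p ∣? n
    ... | yes (divides k refl) = coeff f≈g (ℕ.≤-trans (ℕ.m≤m*n k p) n≤N)
    ... | no  _                = refl

  dilate-q^ : ∀ e → dilate (q^ e) ≈ₛ q^ (p ℕ.* e)
  dilate-q^ e n with p ∣? n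
  ... | yes (divides k refl) = δ-cong (λ k≡e → trans (ℕ.*-comm k p) (cong (p ℕ.*_) k≡e))
                                      (λ k*p≡p*e → ℕ.*-cancelˡ-≡ k e p (trans (ℕ.*-comm p k) k*p≡p*e))
  ... | no  p∤n              = sym (δ-≢ λ n≡p*e → p∤n (divides e (trans n≡p*e (ℕ.*-comm p e))))

  dilate-oneₛ : dilate oneₛ ≈ₛ oneₛ
  dilate-oneₛ n = trans (coeff (dilate-cong {n} {oneₛ} {q^ 0} (modulo λ {i} _ → sym (q^0≈1 i))) ℕ.≤-refl)
    (trans (dilate-q^ 0 n) (trans (cong (λ e → q^ e n) (ℕ.*-zeroʳ p)) (q^0≈1 n)))

  dilate-oneMinusQ^ : ∀ e → dilate (oneMinusQ^ e) ≈ₛ oneMinusQ^ (p ℕ.* e)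
  dilate-oneMinusQ^ e n = trans (trans (coeff (dilate-cong {n} (≈ₛ⇒≈ (oneMinusQ^-q^ e))) ℕ.≤-refl) minus)
    (trans (cong₂ ℤ._+_ (dilate-oneₛ n) (cong ℤ.-_ (dilate-q^ e n))) (sym (oneMinusQ^-q^ (p ℕ.* e) n)))
    where
    minus : dilate (oneₛ ⊕ (⊖ q^ e)) n ≡ dilate oneₛ n ℤ.+ ℤ.- dilate (q^ e) n
    minus with p ∣? n
    ... | yes _ = refl
    ... | no  _ = refl

  module _ {N : ℕ} where
    open Truncated N

    dilate-qPoch : ∀ a m k → dilate (qPoch a m k) ≈ qPoch (p ℕ.* a) (p ℕ.* m) k
    dilate-qPoch a m zero    = ≈ₛ⇒≈ dilate-oneₛ
    dilate-qPoch a m (suc k) = ≈-trans (≈ₛ⇒≈ (dilate-*ₛ (qPoch a m k) (oneMinusQ^ (a ℕ.+ m ℕ.* k))))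
      (*-cong (dilate-qPoch a m k) (≈-trans (≈ₛ⇒≈ (dilate-oneMinusQ^ (a ℕ.+ m ℕ.* k)))
        (reflexive (cong oneMinusQ^ (lemma p a m k)))))
      where
      lemma : ∀ p a m k → p ℕ.* (a ℕ.+ m ℕ.* k) ≡ p ℕ.* a ℕ.+ p ℕ.* m ℕ.* k
      lemma = solve-∀

    dilate-poch : ∀ {a m} → 1 ≤ a → 1 ≤ m → dilate (poch a m) ≈ poch (p ℕ.* a) (p ℕ.* m)
    dilate-poch {a} {m} 1≤a 1≤m = begin
      dilate (poch a m)                 ≈⟨ dilate-cong (poch-truncated 1≤a 1≤m) ⟩
      dilate (qPoch a m N)              ≈⟨ dilate-qPoch a m N ⟩
      qPoch (p ℕ.* a) (p ℕ.* m) N       ≈⟨ poch-truncated (positive 1≤a) (positive 1≤m) ⟨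
      poch (p ℕ.* a) (p ℕ.* m)          ∎
      where
      positive : ∀ {i} → 1 ≤ i → 1 ≤ p ℕ.* i
      positive = ℕ.*-mono-≤ (ℕ.>-nonZero⁻¹ p)

module _ {N : ℕ} where
  open Truncated N

  ∏<-cong : ∀ n {F G : ℕ → Series} → (∀ i → F i ≈ G i) → ∏< n F ≈ ∏< n G
  ∏<-cong zero    F≈G = ≈-refl
  ∏<-cong (suc n) F≈G = *-cong (∏<-cong n F≈G) (F≈G n)

  ∏<-oneₛ : ∀ n → ∏< n (λ _ → oneₛ) ≈ oneₛ
  ∏<-oneₛ zero    = ≈-refl
  ∏<-oneₛ (suc n) = ≈-trans (*-congʳ oneₛ (∏<-oneₛ n)) (≈ₛ⇒≈ (*ₛ-identityˡ oneₛ))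

  ∏<-*ₛ : ∀ n (F G : ℕ → Series) → ∏< n (λ i → F i *ₛ G i) ≈ (∏< n F *ₛ ∏< n G)
  ∏<-*ₛ zero    F G = ≈-sym (≈ₛ⇒≈ (*ₛ-identityˡ oneₛ))
  ∏<-*ₛ (suc n) F G = ≈-trans (*-congʳ (F n *ₛ G n) (∏<-*ₛ n F G))
    (solve 4 (λ a b c d → (a :* b) :* (c :* d) := (a :* c) :* (b :* d)) ≈-refl (∏< n F) (∏< n G) (F n) (G n))

  ∏<-++ : ∀ m n (F : ℕ → Series) → ∏< (m ℕ.+ n) F ≈ (∏< m F *ₛ ∏< n (λ i → F (m ℕ.+ i)))
  ∏<-++ m zero    F rewrite ℕ.+-identityʳ m = solve 1 (λ x → x := x :* con (+ 1)) ≈-refl (∏< m F)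
  ∏<-++ m (suc n) F rewrite ℕ.+-suc m n = ≈-trans (*-congʳ (F (m ℕ.+ n)) (∏<-++ m n F))
    (≈ₛ⇒≈ (*ₛ-assoc (∏< m F) (∏< n (λ i → F (m ℕ.+ i))) (F (m ℕ.+ n))))

  ∏<-grid : ∀ k p (F : ℕ → Series) → ∏< (k ℕ.* p) F ≈ ∏< p (λ i → ∏< k (λ j → F (i ℕ.+ p ℕ.* j)))
  ∏<-grid zero    p F = ≈-sym (∏<-oneₛ p)
  ∏<-grid (suc k) p F = begin
    ∏< (p ℕ.+ k ℕ.* p) F
      ≡⟨ cong (λ i → ∏< i F) (ℕ.+-comm p (k ℕ.* p)) ⟩
    ∏< (k ℕ.* p ℕ.+ p) F
      ≈⟨ ∏<-++ (k ℕ.* p) p F ⟩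
    ∏< (k ℕ.* p) F *ₛ ∏< p (λ i → F (k ℕ.* p ℕ.+ i))
      ≈⟨ *-cong (∏<-grid k p F) (∏<-cong p λ i → reflexive (cong F (lemma k p i))) ⟩
    ∏< p (λ i → ∏< k (λ j → F (i ℕ.+ p ℕ.* j))) *ₛ ∏< p (λ i → F (i ℕ.+ p ℕ.* k))
      ≈⟨ ∏<-*ₛ p (λ i → ∏< k (λ j → F (i ℕ.+ p ℕ.* j))) (λ i → F (i ℕ.+ p ℕ.* k)) ⟨
    ∏< p (λ i → ∏< (suc k) (λ j → F (i ℕ.+ p ℕ.* j))) ∎
    where
    lemma : ∀ k p i → k ℕ.* p ℕ.+ i ≡ i ℕ.+ p ℕ.* k
    lemma = solve-∀

  -- The multiples of c split into p residue classes modulo cp. `multiPoch` covers all of them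
  -- except the multiples of cp, which the second factor restores.
  multiPoch-poch : ∀ p c → 1 ≤ p → 1 ≤ c → (multiPoch p c *ₛ poch (c ℕ.* p) (c ℕ.* p)) ≈ poch c c
  multiPoch-poch (suc p) c 1≤p 1≤c = begin
    ∏< p (λ i → poch (c ℕ.* suc i) (c ℕ.* suc p)) *ₛ poch (c ℕ.* suc p) (c ℕ.* suc p)
      -- Here `p` is the predecessor of the modulus, and the separate factor is definitionally the
      -- last one, i = `p`, of a product over `suc p` classes.
      ≈⟨ ∏<-cong (suc p) (λ i → poch-truncated {c ℕ.* suc i} {c ℕ.* suc p} (positive i) (positive p)) ⟩
    ∏< (suc p) (λ i → qPoch (c ℕ.* suc i) (c ℕ.* suc p) N)
      ≈⟨ ∏<-cong (suc p) (λ i → ∏<-cong N λ j → reflexive (cong oneMinusQ^ (lemma c i p j))) ⟩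
    ∏< (suc p) (λ i → ∏< N (λ j → oneMinusQ^ (c ℕ.+ c ℕ.* (i ℕ.+ suc p ℕ.* j))))
      ≈⟨ ∏<-grid N (suc p) (λ j → oneMinusQ^ (c ℕ.+ c ℕ.* j)) ⟨
    qPoch c c (N ℕ.* suc p)
      ≡⟨ cong (qPoch c c) (trans (ℕ.*-suc N p) (ℕ.+-comm N (N ℕ.* p))) ⟩
    qPoch c c (N ℕ.* p ℕ.+ N)
      ≈⟨ qPoch-stable {c} {c} 1≤c 1≤c (N ℕ.* p) ⟩
    qPoch c c N
      ≈⟨ poch-truncated {c} {c} 1≤c 1≤c ⟨
    poch c c ∎
    where
    positive : ∀ i → 1 ≤ c ℕ.* suc i
    positive i = ℕ.*-mono-≤ 1≤c (s≤s (z≤n {i}))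
    lemma : ∀ c i p j → c ℕ.* suc i ℕ.+ c ℕ.* suc p ℕ.* j ≡ c ℕ.+ c ℕ.* (i ℕ.+ suc p ℕ.* j)
    lemma = solve-∀

-- In coefficient k of the products the only term not settled by smaller indices is f(k) h(0) =
-- f(k); strong induction on k, through the bound of `below`.
*ₛ-cancelʳ : ∀ f g h → h 0 ≡ + 1 → (f *ₛ h) ≈ₛ (g *ₛ h) → f ≈ₛ g
*ₛ-cancelʳ f g h h0≡1 fh≈gh n = below (suc n) ℕ.≤-refl
  where
  open ≡-Reasoning
  last : ∀ f n → f n ℤ.* h (n ℕ.∸ n) ≡ f n
  last f n = trans (cong (f n ℤ.*_) (trans (cong h (ℕ.n∸n≡0 n)) h0≡1)) (ℤ.*-identityʳ (f n))
  below : ∀ m {k} → k < m → f k ≡ g k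
  below (suc m) {k} k<1+m = begin
    f k                  ≡⟨ last f k ⟨
    f k ℤ.* h (k ℕ.∸ k)  ≡⟨ ∙-cancelˡ (Σ< k (λ i → f i ℤ.* h (k ℕ.∸ i))) _ _ (trans (fh≈gh k)
                              (cong (ℤ._+ g k ℤ.* h (k ℕ.∸ k)) (Σ<-cong k λ {i} i<k →
                                cong (ℤ._* h (k ℕ.∸ i)) (sym (below m (ℕ.<-≤-trans i<k (ℕ.≤-pred k<1+m))))))) ⟩
    g k ℤ.* h (k ℕ.∸ k)  ≡⟨ last g k ⟩
    g k                  ∎
    where open import Algebra.Properties.Group (AbelianGroup.group ℤ.+-0-abelianGroup) using (∙-cancelˡ)

-- Theta series and their sections

module _ (p : ℕ) .{{p≢0 : NonZero p}} where
  open Dilation p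

  -- Taking the section of γ(q) Θ(q^p) = Θ(q) gives Y(q) Θ(q) = χ q^(r₁) Θ(q^p), with Y the section
  -- of γ. Since Θ(q^p) = γ′(q) Θ(q), cancelling Θ leaves Y = χ q^(r₁) γ′.
  section-reciprocal : ∀ {γ γ′ Θ χ r₀ r₁} → (γ *ₛ γ′) ≈ₛ oneₛ → (γ *ₛ dilate Θ) ≈ₛ Θ → Θ 0 ≡ + 1 →
    r₀ < p → section r₀ Θ ≈ₛ (χ ∙ (q^ r₁ *ₛ dilate Θ)) → ∀ n → γ ((r₁ ℕ.+ n) ℕ.* p ℕ.+ r₀) ≡ χ ℤ.* γ′ n
  section-reciprocal {γ} {γ′} {Θ} {χ} {r₀} {r₁} γγ′≈1 γVΘ≈Θ Θ0≡1 r₀<p sectionΘ n =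
    trans (Y≈ (r₁ ℕ.+ n)) (cong (χ ℤ.*_) (q^-*ₛ-+ r₁ γ′ n))
    where
    V : Series
    V = dilate Θ
    V≈ : V ≈ₛ (γ′ *ₛ Θ)
    V≈ = ≈⇒≈ₛ λ N → let open Truncated N in begin
      V                   ≈⟨ ≈ₛ⇒≈ (*ₛ-identityˡ V) ⟨
      oneₛ *ₛ V           ≈⟨ *-congʳ V (≈ₛ⇒≈ γγ′≈1) ⟨
      (γ *ₛ γ′) *ₛ V      ≈⟨ solve 3 (λ a b c → (a :* b) :* c := b :* (a :* c)) ≈-refl γ γ′ V ⟩
      γ′ *ₛ (γ *ₛ V)      ≈⟨ *-congˡ γ′ (≈ₛ⇒≈ γVΘ≈Θ) ⟩
      γ′ *ₛ Θ             ∎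
    YΘ≈ : (section r₀ γ *ₛ Θ) ≈ₛ ((χ ∙ (q^ r₁ *ₛ γ′)) *ₛ Θ)
    YΘ≈ m = begin
      (section r₀ γ *ₛ Θ) m              ≡⟨ *ₛ-comm (section r₀ γ) Θ m ⟩
      (Θ *ₛ section r₀ γ) m              ≡⟨ dilate-*ₛ-section Θ γ r₀<p m ⟨
      section r₀ (V *ₛ γ) m              ≡⟨ *ₛ-comm V γ (m ℕ.* p ℕ.+ r₀) ⟩
      section r₀ (γ *ₛ V) m              ≡⟨ γVΘ≈Θ (m ℕ.* p ℕ.+ r₀) ⟩
      section r₀ Θ m                     ≡⟨ sectionΘ m ⟩
      χ ℤ.* (q^ r₁ *ₛ V) m               ≡⟨ cong (χ ℤ.*_) (*ₛ-cong {q^ r₁} (λ _ → refl) V≈ m) ⟩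
      χ ℤ.* (q^ r₁ *ₛ (γ′ *ₛ Θ)) m       ≡⟨ cong (χ ℤ.*_) (*ₛ-assoc (q^ r₁) γ′ Θ m) ⟨
      χ ℤ.* ((q^ r₁ *ₛ γ′) *ₛ Θ) m       ≡⟨ ∙-*ₛ-assoc χ (q^ r₁ *ₛ γ′) Θ m ⟨
      ((χ ∙ (q^ r₁ *ₛ γ′)) *ₛ Θ) m       ∎
      where open ≡-Reasoning
    Y≈ : section r₀ γ ≈ₛ (χ ∙ (q^ r₁ *ₛ γ′))
    Y≈ = *ₛ-cancelʳ (section r₀ γ) (χ ∙ (q^ r₁ *ₛ γ′)) Θ Θ0≡1 YΘ≈

square-injective : ∀ {v w} → v ℕ.* v ≡ w ℕ.* w → v ≡ w
square-injective {v} {w} v²≡w² with ℕ.<-cmp v w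
... | tri< v<w _ _ = ⊥-elim (ℕ.<⇒≢ (ℕ.*-mono-< v<w v<w) v²≡w²)
... | tri≈ _ v≡w _ = v≡w
... | tri> _ _ w<v = ⊥-elim (ℕ.<⇒≢ (ℕ.*-mono-< w<v w<v) (sym v²≡w²))

squareSum : (ℕ → ℤ) → ℕ → ℕ → ℤ
squareSum g W N = Σ< W (λ w → g w ℤ.* δ (w ℕ.* w) N)

squareSum-hit : ∀ g {W w N} → w < W → w ℕ.* w ≡ N → squareSum g W N ≡ g w
squareSum-hit g {w = w} w<W w²≡N = trans
  (Σ<-single w<W λ {v} v≢w → trans (cong (g v ℤ.*_) (δ-≢ λ v²≡N → v≢w (square-injective (trans v²≡N (sym w²≡N))))) (ℤ.*-zeroʳ (g v)))
  (trans (cong (g w ℤ.*_) (δ-≡ w²≡N)) (ℤ.*-identityʳ (g w)))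

squareSum-miss : ∀ g W {N} → (∀ {w} → w < W → w ℕ.* w ≢ N) → squareSum g W N ≡ + 0
squareSum-miss g W w²≢N = Σ<-zero W λ {w} w<W → trans (cong (g w ℤ.*_) (δ-≢ (w²≢N w<W))) (ℤ.*-zeroʳ (g w))

squareSum-extend : ∀ g {W N} d → N < W ℕ.* W → squareSum g (W ℕ.+ d) N ≡ squareSum g W N
squareSum-extend g {W} {N} d N<W² = trans (Σ<-++ W d _) (trans
  (cong (λ x → squareSum g W N ℤ.+ x) (Σ<-zero d λ {k} _ → trans
    (cong (g (W ℕ.+ k) ℤ.*_) (δ-≢ (ℕ.>⇒≢ (ℕ.<-≤-trans N<W² (ℕ.*-mono-≤ (ℕ.m≤m+n W k) (ℕ.m≤m+n W k))))))
    (ℤ.*-zeroʳ (g (W ℕ.+ k)))))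
  (ℤ.+-identityʳ _))

n≤n*n : ∀ n → n ≤ n ℕ.* n
n≤n*n zero    = z≤n
n≤n*n (suc n) = ℕ.m≤m+n (suc n) (n ℕ.* suc n)

-- All roots of N lie below W and, because w ≤ w², also below N + 1; both sums are compared with the
-- one up to W + N + 1.
squareSum-stable : ∀ g {W N} → N < W ℕ.* W → squareSum g W N ≡ squareSum g (suc N) N
squareSum-stable g {W} {N} N<W² = trans (sym (squareSum-extend g {W} (suc N) N<W²)) (trans
  (cong (λ i → squareSum g i N) (ℕ.+-comm W (suc N)))
  (squareSum-extend g {suc N} W (n≤n*n (suc N))))

-- Σ_{w ≥ 0} g(w) q^{(w² - c)/M}, over those w for which the exponent is a natural number.
theta : ℕ → ℕ → (ℕ → ℤ) → Series
theta M c g n = squareSum g (suc (M ℕ.* n ℕ.+ c)) (M ℕ.* n ℕ.+ c)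

theta-hit : ∀ M c g n {w} → w ℕ.* w ≡ M ℕ.* n ℕ.+ c → theta M c g n ≡ g w
theta-hit M c g n {w} w²≡N = squareSum-hit g (s≤s (ℕ.≤-trans (n≤n*n w) (ℕ.≤-reflexive w²≡N))) w²≡N

theta-miss : ∀ M c g n → (∀ {w} → w < suc (M ℕ.* n ℕ.+ c) → w ℕ.* w ≢ M ℕ.* n ℕ.+ c) → theta M c g n ≡ + 0
theta-miss M c g n = squareSum-miss g (suc (M ℕ.* n ℕ.+ c))

module _ {p : ℕ} (p-prime : Prime p) .{{p≢0 : NonZero p}} where
  open Dilation p

  prime∣square : ∀ {w} → p ∣ w ℕ.* w → p ∣ w
  prime∣square {w} p∣w² with euclidsLemma w w p-prime p∣w²
  ... | inj₁ p∣w = p∣w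
  ... | inj₂ p∣w = p∣w

  prime∤⇒∣ : ∀ {m n} → ¬ p ∣ m → p ∣ m ℕ.* n → p ∣ n
  prime∤⇒∣ {m} {n} p∤m p∣mn with euclidsLemma m n p-prime p∣mn
  ... | inj₁ p∣m = ⊥-elim (p∤m p∣m)
  ... | inj₂ p∣n = p∣n

  module _ {M c : ℕ} {r₀ r₁ : ℕ} (c<M : c < M) (p∤M : ¬ p ∣ M)
           (offset : M ℕ.* (r₁ ℕ.* p ℕ.+ r₀) ℕ.+ c ≡ p ℕ.* p ℕ.* c) where

    -- The subtraction-free form of p dividing M(np + r₀) + c, with the quotient Mn + pc - M r₁ made
    -- explicit.
    shifted : ∀ n → (M ℕ.* (n ℕ.* p ℕ.+ r₀) ℕ.+ c) ℕ.+ M ℕ.* r₁ ℕ.* p ≡ (M ℕ.* n ℕ.+ p ℕ.* c) ℕ.* p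
    shifted n = trans (lemma₁ M n p r₀ c r₁) (trans (cong (M ℕ.* n ℕ.* p ℕ.+_) offset) (lemma₂ M n p c))
      where
      lemma₁ : ∀ M n p r₀ c r₁ → (M ℕ.* (n ℕ.* p ℕ.+ r₀) ℕ.+ c) ℕ.+ M ℕ.* r₁ ℕ.* p ≡
                                 M ℕ.* n ℕ.* p ℕ.+ (M ℕ.* (r₁ ℕ.* p ℕ.+ r₀) ℕ.+ c)
      lemma₁ = solve-∀
      lemma₂ : ∀ M n p c → M ℕ.* n ℕ.* p ℕ.+ p ℕ.* p ℕ.* c ≡ (M ℕ.* n ℕ.+ p ℕ.* c) ℕ.* p
      lemma₂ = solve-∀

    root-divisible : ∀ n {w} → w ℕ.* w ≡ M ℕ.* (n ℕ.* p ℕ.+ r₀) ℕ.+ c → p ∣ w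
    root-divisible n {w} w²≡N = prime∣square (subst (p ∣_) (sym w²≡N)
      (∣m+n∣m⇒∣n (divides (M ℕ.* n ℕ.+ p ℕ.* c) (trans (ℕ.+-comm (M ℕ.* r₁ ℕ.* p) _) (shifted n))) (n∣m*n (M ℕ.* r₁))))

    reduced : ∀ n {v} → (v ℕ.* p) ℕ.* (v ℕ.* p) ≡ M ℕ.* (n ℕ.* p ℕ.+ r₀) ℕ.+ c →
              v ℕ.* v ℕ.* p ℕ.+ M ℕ.* r₁ ≡ M ℕ.* n ℕ.+ p ℕ.* c
    reduced n {v} eq = ℕ.*-cancelʳ-≡ _ _ p (trans (lemma v p (M ℕ.* r₁)) (trans (cong (ℕ._+ M ℕ.* r₁ ℕ.* p) eq) (shifted n)))
      where
      lemma : ∀ v p s → (v ℕ.* v ℕ.* p ℕ.+ s) ℕ.* p ≡ (v ℕ.* p) ℕ.* (v ℕ.* p) ℕ.+ s ℕ.* p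
      lemma = solve-∀

    -- With r₁ = n + 1 + e the reduced equation is v²p + M(e + 1) = pc. Hence p divides e + 1, and
    -- dividing by p makes c at least M. This is where c < M enters.
    no-root-below : ∀ {n v} → n < r₁ → (v ℕ.* p) ℕ.* (v ℕ.* p) ≢ M ℕ.* (n ℕ.* p ℕ.+ r₀) ℕ.+ c
    no-root-below {n} {v} n<r₁ eq with ℕ.m≤n⇒∃[o]m+o≡n n<r₁
    ... | e , refl = contra (prime∤⇒∣ p∤M (∣m+n∣m⇒∣n (divides c (trans eq₁ (ℕ.*-comm p c))) (n∣m*n (v ℕ.* v))))
      where
      eq₁ : v ℕ.* v ℕ.* p ℕ.+ M ℕ.* suc e ≡ p ℕ.* c
      eq₁ = ℕ.+-cancelˡ-≡ (M ℕ.* n) _ _ (trans (lemma M n (v ℕ.* v ℕ.* p) e) (reduced n {v} eq))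
        where
        lemma : ∀ M n s e → M ℕ.* n ℕ.+ (s ℕ.+ M ℕ.* suc e) ≡ s ℕ.+ M ℕ.* (suc n ℕ.+ e)
        lemma = solve-∀
      contra : p ∣ suc e → ⊥
      contra (divides (suc f) 1+e≡f*p) = ℕ.<⇒≱ c<M (ℕ.≤-trans (ℕ.m≤m*n M (suc f))
        (ℕ.≤-trans (ℕ.m≤n+m (M ℕ.* suc f) (v ℕ.* v)) (ℕ.≤-reflexive (ℕ.*-cancelʳ-≡ _ _ p
          (trans (lemma v p M (suc f)) (trans (cong (λ i → v ℕ.* v ℕ.* p ℕ.+ M ℕ.* i) (sym 1+e≡f*p)) (trans eq₁ (ℕ.*-comm p c))))))))
        where
        lemma : ∀ v p M f → (v ℕ.* v ℕ.+ M ℕ.* f) ℕ.* p ≡ v ℕ.* v ℕ.* p ℕ.+ M ℕ.* (f ℕ.* p)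
        lemma = solve-∀

    -- The reduced equation becomes v²p = Md + pc, so p divides Md and hence d, as p does not divide
    -- M; a second division by p gives the original equation.
    root-above : ∀ {d v} → (v ℕ.* p) ℕ.* (v ℕ.* p) ≡ M ℕ.* ((r₁ ℕ.+ d) ℕ.* p ℕ.+ r₀) ℕ.+ c →
                 ∃ λ e → d ≡ e ℕ.* p × v ℕ.* v ≡ M ℕ.* e ℕ.+ c
    root-above {d} {v} eq = conclude (prime∤⇒∣ p∤M (∣m+n∣m⇒∣n
        (divides (v ℕ.* v) (trans (ℕ.+-comm (p ℕ.* c) (M ℕ.* d)) (sym eq₁))) (m∣m*n c)))
      where
      eq₁ : v ℕ.* v ℕ.* p ≡ M ℕ.* d ℕ.+ p ℕ.* c
      eq₁ = ℕ.+-cancelʳ-≡ (M ℕ.* r₁) _ _ (trans (reduced (r₁ ℕ.+ d) {v} eq) (lemma M r₁ d (p ℕ.* c)))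
        where
        lemma : ∀ M r d s → M ℕ.* (r ℕ.+ d) ℕ.+ s ≡ M ℕ.* d ℕ.+ s ℕ.+ M ℕ.* r
        lemma = solve-∀
      conclude : p ∣ d → ∃ λ e → d ≡ e ℕ.* p × v ℕ.* v ≡ M ℕ.* e ℕ.+ c
      conclude (divides e refl) = e , refl , ℕ.*-cancelʳ-≡ _ _ p (trans eq₁ (lemma M e p c))
        where
        lemma : ∀ M e p c → M ℕ.* (e ℕ.* p) ℕ.+ p ℕ.* c ≡ (M ℕ.* e ℕ.+ c) ℕ.* p
        lemma = solve-∀

    -- Converse of `root-above`: if the large exponent has no root, neither has the small one, so
    -- both sides of `theta-section` vanish together.
    root-lift : ∀ {e v} → v ℕ.* v ≡ M ℕ.* e ℕ.+ c →
                (v ℕ.* p) ℕ.* (v ℕ.* p) ≡ M ℕ.* ((r₁ ℕ.+ e ℕ.* p) ℕ.* p ℕ.+ r₀) ℕ.+ c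
    root-lift {e} {v} v²≡ = ℕ.+-cancelʳ-≡ (M ℕ.* r₁ ℕ.* p) _ _ (trans (lemma₁ v p (M ℕ.* r₁)) (trans
      (cong (λ i → (i ℕ.* p ℕ.+ M ℕ.* r₁) ℕ.* p) v²≡) (trans (lemma₂ M e c p r₁) (sym (shifted (r₁ ℕ.+ e ℕ.* p))))))
      where
      lemma₁ : ∀ v p s → (v ℕ.* p) ℕ.* (v ℕ.* p) ℕ.+ s ℕ.* p ≡ (v ℕ.* v ℕ.* p ℕ.+ s) ℕ.* p
      lemma₁ = solve-∀
      lemma₂ : ∀ M e c p r → ((M ℕ.* e ℕ.+ c) ℕ.* p ℕ.+ M ℕ.* r) ℕ.* p ≡ (M ℕ.* (r ℕ.+ e ℕ.* p) ℕ.+ p ℕ.* c) ℕ.* p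
      lemma₂ = solve-∀

    -- Mn' + c = w² with n' = np + r₀ forces p ∣ w, and dividing by p² gives the same equation for (n - r₁)/p.
    theta-section : ∀ {g χ} → (∀ w → g (w ℕ.* p) ≡ χ ℤ.* g w) →
                    section r₀ (theta M c g) ≈ₛ (χ ∙ (q^ r₁ *ₛ dilate (theta M c g)))
    theta-section {g} {χ} g-* n with ℕ.anyUpTo? (λ w → w ℕ.* w ℕ.≟ M ℕ.* (n ℕ.* p ℕ.+ r₀) ℕ.+ c)
                                     (suc (M ℕ.* (n ℕ.* p ℕ.+ r₀) ℕ.+ c)) | n ℕ.<? r₁
    ... | yes (w , _ , w²≡N) | yes n<r₁ with root-divisible n {w} w²≡N
    ...   | divides v refl = ⊥-elim (no-root-below {n} {v} n<r₁ w²≡N)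
    theta-section {g} {χ} g-* n | yes (w , _ , w²≡N) | no n≮r₁ with root-divisible n {w} w²≡N | ℕ.m≤n⇒∃[o]m+o≡n (ℕ.≮⇒≥ n≮r₁)
    ...   | divides v refl | d , refl with root-above {d} {v} w²≡N
    ...     | e , refl , v²≡ = begin
      theta M c g ((r₁ ℕ.+ e ℕ.* p) ℕ.* p ℕ.+ r₀)     ≡⟨ theta-hit M c g _ w²≡N ⟩
      g (v ℕ.* p)                                     ≡⟨ g-* v ⟩
      χ ℤ.* g v                                       ≡⟨ cong (χ ℤ.*_) (theta-hit M c g e v²≡) ⟨
      χ ℤ.* theta M c g e                             ≡⟨ cong (χ ℤ.*_) (dilate-* (theta M c g) e) ⟨
      χ ℤ.* dilate (theta M c g) (e ℕ.* p)            ≡⟨ cong (χ ℤ.*_) (q^-*ₛ-+ r₁ (dilate (theta M c g)) (e ℕ.* p)) ⟨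
      χ ℤ.* (q^ r₁ *ₛ dilate (theta M c g)) (r₁ ℕ.+ e ℕ.* p) ∎
      where open ≡-Reasoning
    theta-section {g} {χ} g-* n | no none | n<?r₁ = trans
      (theta-miss M c g (n ℕ.* p ℕ.+ r₀) λ {w} w<1+N w²≡N → none (w , w<1+N , w²≡N))
      (sym (trans (cong (χ ℤ.*_) (vanishes n<?r₁)) (ℤ.*-zeroʳ χ)))
      where
      dilated-vanishes : ∀ d → r₁ ℕ.+ d ≡ n → dilate (theta M c g) d ≡ + 0
      dilated-vanishes d r₁+d≡n with p ∣? d
      ... | no  p∤d              = refl
      ... | yes (divides e refl) = theta-miss M c g e λ {v} _ v²≡ →
        let w²≡N = subst (λ i → (v ℕ.* p) ℕ.* (v ℕ.* p) ≡ M ℕ.* (i ℕ.* p ℕ.+ r₀) ℕ.+ c) r₁+d≡n (root-lift {e} {v} v²≡)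
        in none (v ℕ.* p , s≤s (ℕ.≤-trans (n≤n*n (v ℕ.* p)) (ℕ.≤-reflexive w²≡N)) , w²≡N)
      vanishes : Dec (n < r₁) → (q^ r₁ *ₛ dilate (theta M c g)) n ≡ + 0
      vanishes (yes n<r₁) = q^-*ₛ-< r₁ (dilate (theta M c g)) n<r₁
      vanishes (no  n≮r₁) with ℕ.m≤n⇒∃[o]m+o≡n (ℕ.≮⇒≥ n≮r₁)
      ... | d , r₁+d≡n = trans (cong (q^ r₁ *ₛ dilate (theta M c g)) (sym r₁+d≡n))
        (trans (q^-*ₛ-+ r₁ (dilate (theta M c g)) d) (dilated-vanishes d r₁+d≡n))

-- Pentagonal, square and triangular expansions

[-1]^ : ℕ → ℤ
[-1]^ k = -[1+ 0 ] ℤ.^ k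

sgn-∙ : ∀ k → sgn k ≈ₛ ([-1]^ k ∙ oneₛ)
sgn-∙ zero    n = sym (ℤ.*-identityˡ (oneₛ n))
sgn-∙ (suc k) n = trans (cong ℤ.-_ (sgn-∙ k n))
  (solve 2 (λ a b → :- (a :* b) := (con -[1+ 0 ] :* a) :* b) refl ([-1]^ k) (oneₛ n))
  where open ℤ.+-*-Solver

sgn-*ₛ : ∀ k f n → (sgn k *ₛ f) n ≡ [-1]^ k ℤ.* f n
sgn-*ₛ k f n = trans (*ₛ-cong {g = f} (sgn-∙ k) (λ _ → refl) n)
  (trans (∙-*ₛ-assoc ([-1]^ k) oneₛ f n) (cong ([-1]^ k ℤ.*_) (*ₛ-identityˡ f n)))

[-1]^-even : ∀ k → [-1]^ (k ℕ.* 2) ≡ + 1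
[-1]^-even k = trans (cong [-1]^ (ℕ.*-comm k 2)) (trans (sym (ℤ.^-*-assoc -[1+ 0 ] 2 k)) (ℤ.^-zeroˡ k))

δ-affine : ∀ M c e {n a} .{{_ : NonZero M}} → a ≡ M ℕ.* e ℕ.+ c → δ a (M ℕ.* n ℕ.+ c) ≡ δ n e
δ-affine M c e {n} {a} a≡ = δ-cong
  (λ a≡′ → ℕ.*-cancelˡ-≡ n e M (ℕ.+-cancelʳ-≡ c _ _ (trans (sym a≡′) a≡)))
  (λ n≡e → trans a≡ (cong (λ i → M ℕ.* i ℕ.+ c) (sym n≡e)))

tri-double : ∀ k → 2 ℕ.* tri k ≡ k ℕ.* suc k
tri-double zero    = refl
tri-double (suc k) = trans (ℕ.*-distribˡ-+ 2 (tri k) (suc k))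
  (trans (cong (ℕ._+ 2 ℕ.* suc k) (tri-double k)) (lemma k))
  where
  lemma : ∀ k → k ℕ.* suc k ℕ.+ 2 ℕ.* suc k ≡ suc k ℕ.* suc (suc k)
  lemma = solve-∀

-- The Dirichlet character modulo 12 with χ₁₂(±1) = 1 and χ₁₂(±5) = -1.
χ₁₂ : ℕ → ℤ
χ₁₂ 0 = + 0
χ₁₂ 1 = + 1
χ₁₂ 2 = + 0
χ₁₂ 3 = + 0
χ₁₂ 4 = + 0
χ₁₂ 5 = -[1+ 0 ]
χ₁₂ (suc (suc (suc (suc (suc (suc w)))))) = ℤ.- χ₁₂ w

χ₁₂-shift : ∀ k j → χ₁₂ (k ℕ.* 6 ℕ.+ j) ≡ [-1]^ k ℤ.* χ₁₂ j
χ₁₂-shift zero    j = sym (ℤ.*-identityˡ (χ₁₂ j))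
χ₁₂-shift (suc k) j = trans (cong ℤ.-_ (χ₁₂-shift k j))
  (solve 2 (λ a b → :- (a :* b) := (con -[1+ 0 ] :* a) :* b) refl ([-1]^ k) (χ₁₂ j))
  where open ℤ.+-*-Solver

χ₁₂-%12 : ∀ n → χ₁₂ n ≡ χ₁₂ (n ℕ.% 12)
χ₁₂-%12 n = begin
  χ₁₂ n                                             ≡⟨ cong χ₁₂ (trans (m≡m%n+[m/n]*n n 12) (lemma (n ℕ.% 12) (n ℕ./ 12))) ⟩
  χ₁₂ ((n ℕ./ 12) ℕ.* 2 ℕ.* 6 ℕ.+ n ℕ.% 12)         ≡⟨ χ₁₂-shift ((n ℕ./ 12) ℕ.* 2) (n ℕ.% 12) ⟩
  [-1]^ ((n ℕ./ 12) ℕ.* 2) ℤ.* χ₁₂ (n ℕ.% 12)       ≡⟨ cong (ℤ._* χ₁₂ (n ℕ.% 12)) ([-1]^-even (n ℕ./ 12)) ⟩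
  + 1 ℤ.* χ₁₂ (n ℕ.% 12)                            ≡⟨ ℤ.*-identityˡ (χ₁₂ (n ℕ.% 12)) ⟩
  χ₁₂ (n ℕ.% 12)                                    ∎
  where
  open ≡-Reasoning
  lemma : ∀ r k → r ℕ.+ k ℕ.* 12 ≡ k ℕ.* 2 ℕ.* 6 ℕ.+ r
  lemma = solve-∀

-- By periodicity modulo 12 this is a check of 144 pairs of residues, settled by evaluation.
χ₁₂-* : ∀ m n → χ₁₂ (m ℕ.* n) ≡ χ₁₂ m ℤ.* χ₁₂ n
χ₁₂-* m n = begin
  χ₁₂ (m ℕ.* n)                                  ≡⟨ χ₁₂-%12 (m ℕ.* n) ⟩
  χ₁₂ (m ℕ.* n ℕ.% 12)                           ≡⟨ cong χ₁₂ (%-distribˡ-* m n 12) ⟩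
  χ₁₂ ((m ℕ.% 12) ℕ.* (n ℕ.% 12) ℕ.% 12)         ≡⟨ residues (m%n<n m 12) (m%n<n n 12) ⟩
  χ₁₂ (m ℕ.% 12) ℤ.* χ₁₂ (n ℕ.% 12)              ≡⟨ cong₂ ℤ._*_ (χ₁₂-%12 m) (χ₁₂-%12 n) ⟨
  χ₁₂ m ℤ.* χ₁₂ n                                ∎
  where
  open ≡-Reasoning
  residues : ∀ {i} → i < 12 → ∀ {j} → j < 12 → χ₁₂ (i ℕ.* j ℕ.% 12) ≡ χ₁₂ i ℤ.* χ₁₂ j
  residues = toWitness {a? = ℕ.allUpTo? (λ i → ℕ.allUpTo? (λ j → χ₁₂ (i ℕ.* j ℕ.% 12) ℤ.≟ χ₁₂ i ℤ.* χ₁₂ j) 12) 12} _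

-- For s = K + 1, 24 · s(3s ∓ 1)/2 + 1 = (6s ∓ 1)². The new values w = 6K + 2, ..., 6K + 7 contain
-- just these two roots prime to 6, where χ₁₂ is (-1)^s; the initial bound 2 admits w = 1, the
-- constant term.
pentagonal-partialSum : ∀ K n → Pentagonal.partialSum K n ≡ squareSum χ₁₂ (K ℕ.* 6 ℕ.+ 2) (24 ℕ.* n ℕ.+ 1)
pentagonal-partialSum zero    n = begin
  oneₛ n                                ≡⟨ q^0≈1 n ⟨
  δ n 0                                 ≡⟨ δ-affine 24 1 0 {n} refl ⟨
  δ 1 (24 ℕ.* n ℕ.+ 1)                  ≡⟨ ℤ.*-identityˡ _ ⟨
  + 1 ℤ.* δ 1 (24 ℕ.* n ℕ.+ 1)          ≡⟨ ℤ.+-identityˡ _ ⟨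
  squareSum χ₁₂ 2 (24 ℕ.* n ℕ.+ 1)      ∎
  where open ≡-Reasoning
pentagonal-partialSum (suc K) n = begin
  Pentagonal.partialSum K n ℤ.+ (sgn (suc K) *ₛ (q^ e₁ ⊕ q^ e₂)) n
    ≡⟨ cong₂ ℤ._+_ (pentagonal-partialSum K n) (sgn-*ₛ (suc K) (q^ e₁ ⊕ q^ e₂) n) ⟩
  squareSum χ₁₂ X N ℤ.+ [-1]^ (suc K) ℤ.* (δ n e₁ ℤ.+ δ n e₂)
    -- The sum is padded with zero terms for w = 6K + 2, 6K + 3, 6K + 4 and 6K + 6, where χ₁₂
    -- vanishes.
    ≡⟨ solve 8 (λ a s x y u v w z → a :+ (con -[1+ 0 ] :* s) :* (x :+ y) :=
         (((((a :+ (s :* con (+ 0)) :* u) :+ (s :* con (+ 0)) :* v) :+ (s :* con (+ 0)) :* w) :+ (s :* con -[1+ 0 ]) :* x)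
           :+ (s :* con (+ 0)) :* z) :+ (s :* con -[1+ 0 ]) :* y) refl
         (squareSum χ₁₂ X N) ([-1]^ K) (δ n e₁) (δ n e₂) (d 0) (d 1) (d 2) (d 4) ⟩
  (((((squareSum χ₁₂ X N ℤ.+ ([-1]^ K ℤ.* χ₁₂ 2) ℤ.* d 0) ℤ.+ ([-1]^ K ℤ.* χ₁₂ 3) ℤ.* d 1) ℤ.+ ([-1]^ K ℤ.* χ₁₂ 4) ℤ.* d 2)
    ℤ.+ ([-1]^ K ℤ.* χ₁₂ 5) ℤ.* δ n e₁) ℤ.+ ([-1]^ K ℤ.* χ₁₂ 6) ℤ.* d 4) ℤ.+ ([-1]^ K ℤ.* χ₁₂ 7) ℤ.* δ n e₂
    ≡⟨ cong₂ ℤ._+_ (cong₂ ℤ._+_ (cong₂ ℤ._+_ (cong₂ ℤ._+_ (cong₂ ℤ._+_ (cong (λ x → squareSum χ₁₂ X N ℤ.+ x)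
         (cong (ℤ._* d 0) (χ 0))) (cong (ℤ._* d 1) (χ 1))) (cong (ℤ._* d 2) (χ 2)))
         (cong₂ ℤ._*_ (χ 3) (sym (δ-affine 24 1 e₁ {n} square₁)))) (cong (ℤ._* d 4) (χ 4)))
         (cong₂ ℤ._*_ (χ 5) (sym (δ-affine 24 1 e₂ {n} square₂))) ⟩
  squareSum χ₁₂ (6 ℕ.+ X) N ∎
  where
  open ≡-Reasoning
  open ℤ.+-*-Solver
  X N e₁ e₂ : ℕ
  X = K ℕ.* 6 ℕ.+ 2
  N = 24 ℕ.* n ℕ.+ 1
  e₁ = suc K ℕ.* K ℕ.+ tri (suc K)
  e₂ = suc K ℕ.* suc K ℕ.+ tri (suc K)
  d : ℕ → ℤ
  d i = δ ((i ℕ.+ X) ℕ.* (i ℕ.+ X)) N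
  χ : ∀ i → [-1]^ K ℤ.* χ₁₂ (2 ℕ.+ i) ≡ χ₁₂ (i ℕ.+ X)
  χ i = trans (sym (χ₁₂-shift K (2 ℕ.+ i))) (cong χ₁₂ (lemma K i))
    where
    lemma : ∀ K i → K ℕ.* 6 ℕ.+ (2 ℕ.+ i) ≡ i ℕ.+ (K ℕ.* 6 ℕ.+ 2)
    lemma = solve-∀
  -- The ring solver cannot see into `tri`, so 24 · `tri (suc K)` is traded for 12(K + 1)(K + 2)
  -- through `tri-double`.
  square : ∀ a b → a ℕ.+ 12 ℕ.* (suc K ℕ.* suc (suc K)) ≡ b → a ℕ.+ 12 ℕ.* (2 ℕ.* tri (suc K)) ≡ b
  square a b = trans (cong (λ i → a ℕ.+ 12 ℕ.* i) (tri-double (suc K)))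
  square₁ : (3 ℕ.+ X) ℕ.* (3 ℕ.+ X) ≡ 24 ℕ.* e₁ ℕ.+ 1
  square₁ = trans (sym (square (24 ℕ.* (suc K ℕ.* K) ℕ.+ 1) _ (lemma K))) (lemma′ (suc K ℕ.* K) (tri (suc K)))
    where
    lemma : ∀ K → 24 ℕ.* (suc K ℕ.* K) ℕ.+ 1 ℕ.+ 12 ℕ.* (suc K ℕ.* suc (suc K)) ≡
            (3 ℕ.+ (K ℕ.* 6 ℕ.+ 2)) ℕ.* (3 ℕ.+ (K ℕ.* 6 ℕ.+ 2))
    lemma = solve-∀
    lemma′ : ∀ a t → 24 ℕ.* a ℕ.+ 1 ℕ.+ 12 ℕ.* (2 ℕ.* t) ≡ 24 ℕ.* (a ℕ.+ t) ℕ.+ 1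
    lemma′ = solve-∀
  square₂ : (5 ℕ.+ X) ℕ.* (5 ℕ.+ X) ≡ 24 ℕ.* e₂ ℕ.+ 1
  square₂ = trans (sym (square (24 ℕ.* (suc K ℕ.* suc K) ℕ.+ 1) _ (lemma K))) (lemma′ (suc K ℕ.* suc K) (tri (suc K)))
    where
    lemma : ∀ K → 24 ℕ.* (suc K ℕ.* suc K) ℕ.+ 1 ℕ.+ 12 ℕ.* (suc K ℕ.* suc (suc K)) ≡
            (5 ℕ.+ (K ℕ.* 6 ℕ.+ 2)) ℕ.* (5 ℕ.+ (K ℕ.* 6 ℕ.+ 2))
    lemma = solve-∀
    lemma′ : ∀ a t → 24 ℕ.* a ℕ.+ 1 ℕ.+ 12 ℕ.* (2 ℕ.* t) ≡ 24 ℕ.* (a ℕ.+ t) ℕ.+ 1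
    lemma′ = solve-∀

-- Coefficients of the sum of (-1)^w q^(w²) over all integers w, with w and -w merged.
doubled : ℕ → ℤ
doubled zero    = + 1
doubled (suc w) = [-1]^ (suc w) ℤ.+ [-1]^ (suc w)

square-partialSum : ∀ K n → SquareSum.partialSum K n ≡ squareSum doubled (suc K) (1 ℕ.* n ℕ.+ 0)
square-partialSum zero    n = begin
  oneₛ n                                ≡⟨ q^0≈1 n ⟨
  δ n 0                                 ≡⟨ δ-affine 1 0 0 {n} refl ⟨
  δ 0 (1 ℕ.* n ℕ.+ 0)                   ≡⟨ ℤ.*-identityˡ _ ⟨
  + 1 ℤ.* δ 0 (1 ℕ.* n ℕ.+ 0)           ≡⟨ ℤ.+-identityˡ _ ⟨
  squareSum doubled 1 (1 ℕ.* n ℕ.+ 0)   ∎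
  where open ≡-Reasoning
square-partialSum (suc K) n = cong₂ ℤ._+_ (square-partialSum K n) (begin
  ((sgn (suc K) ⊕ sgn (suc K)) *ₛ q^ e) n
    ≡⟨ *ₛ-distribʳ (q^ e) (sgn (suc K)) (sgn (suc K)) n ⟩
  (sgn (suc K) *ₛ q^ e) n ℤ.+ (sgn (suc K) *ₛ q^ e) n
    ≡⟨ cong (λ x → x ℤ.+ x) (sgn-*ₛ (suc K) (q^ e) n) ⟩
  [-1]^ (suc K) ℤ.* δ n e ℤ.+ [-1]^ (suc K) ℤ.* δ n e
    ≡⟨ ℤ.*-distribʳ-+ (δ n e) ([-1]^ (suc K)) ([-1]^ (suc K)) ⟨
  doubled (suc K) ℤ.* δ n e
    ≡⟨ cong (doubled (suc K) ℤ.*_) (δ-affine 1 0 e {n} (lemma e)) ⟨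
  doubled (suc K) ℤ.* δ e (1 ℕ.* n ℕ.+ 0) ∎)
  where
  open ≡-Reasoning
  e : ℕ
  e = suc K ℕ.* suc K
  lemma : ∀ e → e ≡ 1 ℕ.* e ℕ.+ 0
  lemma = solve-∀

-- Since 8 · m(m + 1)/2 + 1 = (2m + 1)², the triangular numbers for m = 2K + 1 and 2K + 2 come from
-- w = 4K + 3 and 4K + 5. The even w can carry coefficient 1 as well, because an even square is
-- never 8n + 1.
triangular-partialSum : ∀ K n → TriangularSum.partialSum K n ≡ squareSum (λ _ → + 1) (K ℕ.* 4 ℕ.+ 2) (8 ℕ.* n ℕ.+ 1)
triangular-partialSum zero    n = begin
  oneₛ n                                          ≡⟨ q^0≈1 n ⟨
  δ n 0                                           ≡⟨ δ-affine 8 1 0 {n} refl ⟨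
  δ 1 (8 ℕ.* n ℕ.+ 1)                             ≡⟨ ℤ.*-identityˡ _ ⟨
  + 1 ℤ.* δ 1 (8 ℕ.* n ℕ.+ 1)                     ≡⟨ ℤ.+-identityˡ _ ⟨
  + 0 ℤ.+ + 1 ℤ.* δ 1 (8 ℕ.* n ℕ.+ 1)             ≡⟨ cong (λ x → + 1 ℤ.* x ℤ.+ + 1 ℤ.* δ 1 (8 ℕ.* n ℕ.+ 1))
                                                       (δ-≢ λ 0≡ → ℕ.m+1+n≢0 (8 ℕ.* n) (sym 0≡)) ⟨
  + 1 ℤ.* δ 0 (8 ℕ.* n ℕ.+ 1) ℤ.+ + 1 ℤ.* δ 1 (8 ℕ.* n ℕ.+ 1)
    ≡⟨ cong (ℤ._+ + 1 ℤ.* δ 1 (8 ℕ.* n ℕ.+ 1)) (ℤ.+-identityˡ (+ 1 ℤ.* δ 0 (8 ℕ.* n ℕ.+ 1))) ⟨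
  squareSum (λ _ → + 1) 2 (8 ℕ.* n ℕ.+ 1)         ∎
  where open ≡-Reasoning
triangular-partialSum (suc K) n = begin
  TriangularSum.partialSum K n ℤ.+ (δ n e₁ ℤ.+ δ n e₂)
    ≡⟨ cong (ℤ._+ (δ n e₁ ℤ.+ δ n e₂)) (triangular-partialSum K n) ⟩
  S ℤ.+ (δ n e₁ ℤ.+ δ n e₂)
    ≡⟨ solve 3 (λ a x y → a :+ (x :+ y) :=
         (((a :+ con (+ 1) :* con (+ 0)) :+ con (+ 1) :* x) :+ con (+ 1) :* con (+ 0)) :+ con (+ 1) :* y) refl S (δ n e₁) (δ n e₂) ⟩
  (((S ℤ.+ + 1 ℤ.* + 0) ℤ.+ + 1 ℤ.* δ n e₁) ℤ.+ + 1 ℤ.* + 0) ℤ.+ + 1 ℤ.* δ n e₂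
    ≡⟨ cong₂ ℤ._+_ (cong₂ ℤ._+_ (cong₂ ℤ._+_ (cong (λ x → S ℤ.+ + 1 ℤ.* x)
         (even (1 ℕ.+ 2 ℕ.* K) (even₀ K))) (cong (+ 1 ℤ.*_) (sym (δ-affine 8 1 e₁ {n} (square₁ K)))))
         (cong (+ 1 ℤ.*_) (even (2 ℕ.+ 2 ℕ.* K) (even₂ K))))
         (cong (+ 1 ℤ.*_) (sym (δ-affine 8 1 e₂ {n} (square₂ K)))) ⟩
  squareSum (λ _ → + 1) (4 ℕ.+ X) N ∎
  where
  open ≡-Reasoning
  open ℤ.+-*-Solver
  X N e₁ e₂ : ℕ
  X = K ℕ.* 4 ℕ.+ 2
  N = 8 ℕ.* n ℕ.+ 1
  e₁ = suc K ℕ.* (1 ℕ.+ 2 ℕ.* K)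
  e₂ = suc K ℕ.* (1 ℕ.+ 2 ℕ.* suc K)
  S : ℤ
  S = squareSum (λ _ → + 1) X N
  even : ∀ h {w} → w ≡ 2 ℕ.* h → + 0 ≡ δ (w ℕ.* w) N
  even h {w} w≡2h = sym (δ-≢ λ w²≡N → ℕ.even≢odd (h ℕ.* w) (4 ℕ.* n)
    (trans (trans (sym (ℕ.*-assoc 2 h w)) (trans (cong (ℕ._* w) (sym w≡2h)) w²≡N)) (lemma n)))
    where
    lemma : ∀ n → 8 ℕ.* n ℕ.+ 1 ≡ suc (2 ℕ.* (4 ℕ.* n))
    lemma = solve-∀
  even₀ : ∀ K → K ℕ.* 4 ℕ.+ 2 ≡ 2 ℕ.* (1 ℕ.+ 2 ℕ.* K)
  even₀ = solve-∀
  even₂ : ∀ K → 2 ℕ.+ (K ℕ.* 4 ℕ.+ 2) ≡ 2 ℕ.* (2 ℕ.+ 2 ℕ.* K)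
  even₂ = solve-∀
  square₁ : ∀ K → (1 ℕ.+ (K ℕ.* 4 ℕ.+ 2)) ℕ.* (1 ℕ.+ (K ℕ.* 4 ℕ.+ 2)) ≡ 8 ℕ.* (suc K ℕ.* (1 ℕ.+ 2 ℕ.* K)) ℕ.+ 1
  square₁ = solve-∀
  square₂ : ∀ K → (3 ℕ.+ (K ℕ.* 4 ℕ.+ 2)) ℕ.* (3 ℕ.+ (K ℕ.* 4 ℕ.+ 2)) ≡ 8 ℕ.* (suc K ℕ.* (1 ℕ.+ 2 ℕ.* suc K)) ℕ.+ 1
  square₂ = solve-∀

Θ₁ Θ₂ Θ₃ : Series
Θ₁ = theta 24 1 χ₁₂
Θ₂ = theta 1 0 doubled
Θ₃ = theta 8 1 (λ _ → + 1)

-- The partial sum reaches every root needed up to degree N because 24N + 1 < (6N + 2)².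
partialSum≈Θ₁ : ∀ {N} → Pentagonal.partialSum N ≈[ N ] Θ₁
partialSum≈Θ₁ {N} = modulo λ {n} n≤N → trans (pentagonal-partialSum N n)
  (squareSum-stable χ₁₂ {N ℕ.* 6 ℕ.+ 2} (ℕ.≤-trans (s≤s (ℕ.+-monoˡ-≤ 1 (ℕ.*-monoʳ-≤ 24 n≤N)))
    (ℕ.≤-trans (ℕ.m≤m+n (suc (24 ℕ.* N ℕ.+ 1)) _) (ℕ.≤-reflexive (sym (lemma N))))))
  where
  lemma : ∀ N → (N ℕ.* 6 ℕ.+ 2) ℕ.* (N ℕ.* 6 ℕ.+ 2) ≡ suc (24 ℕ.* N ℕ.+ 1) ℕ.+ (36 ℕ.* (N ℕ.* N) ℕ.+ 2)
  lemma = solve-∀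

partialSum≈Θ₂ : ∀ {N} → SquareSum.partialSum N ≈[ N ] Θ₂
partialSum≈Θ₂ {N} = modulo λ {n} n≤N → trans (square-partialSum N n)
  (squareSum-stable doubled {suc N} (ℕ.≤-trans (s≤s (ℕ.+-monoˡ-≤ 0 (ℕ.*-monoʳ-≤ 1 n≤N)))
    (ℕ.≤-trans (ℕ.m≤m+n (suc (1 ℕ.* N ℕ.+ 0)) _) (ℕ.≤-reflexive (sym (lemma N))))))
  where
  lemma : ∀ N → suc N ℕ.* suc N ≡ suc (1 ℕ.* N ℕ.+ 0) ℕ.+ (N ℕ.* N ℕ.+ N)
  lemma = solve-∀

partialSum≈Θ₃ : ∀ {N} → TriangularSum.partialSum N ≈[ N ] Θ₃
partialSum≈Θ₃ {N} = modulo λ {n} n≤N → trans (triangular-partialSum N n)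
  (squareSum-stable (λ _ → + 1) {N ℕ.* 4 ℕ.+ 2} (ℕ.≤-trans (s≤s (ℕ.+-monoˡ-≤ 1 (ℕ.*-monoʳ-≤ 8 n≤N)))
    (ℕ.≤-trans (ℕ.m≤m+n (suc (8 ℕ.* N ℕ.+ 1)) _) (ℕ.≤-reflexive (sym (lemma N))))))
  where
  lemma : ∀ N → (N ℕ.* 4 ℕ.+ 2) ℕ.* (N ℕ.* 4 ℕ.+ 2) ≡ suc (8 ℕ.* N ℕ.+ 1) ℕ.+ (16 ℕ.* (N ℕ.* N) ℕ.+ 8 ℕ.* N ℕ.+ 2)
  lemma = solve-∀

module _ {N : ℕ} where
  open Truncated N

  euler-pentagonal : poch 1 1 ≈ Θ₁
  euler-pentagonal = ≈-trans (poch-truncated {1} {1} (s≤s z≤n) (s≤s z≤n))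
    (≈-trans (Pentagonal.truncated-pentagonal N) partialSum≈Θ₁)

  gauss-squares : (Θ₂ *ₛ poch 2 2) ≈ (poch 1 1 *ₛ poch 1 1)
  gauss-squares = ≈-trans (*-congʳ (poch 2 2) (≈-sym partialSum≈Θ₂)) (SquareSum.truncated-gauss N)

  gauss-triangular : (Θ₃ *ₛ poch 1 1) ≈ (poch 2 2 *ₛ poch 2 2)
  gauss-triangular = ≈-trans (*-congʳ (poch 1 1) (≈-sym partialSum≈Θ₃)) (TriangularSum.truncated-gauss N)

-- Functional equations of γ and the coefficient identity

module _ (p : ℕ) .{{p≢0 : NonZero p}} where
  open Dilation p

  multiPoch-dilate : ∀ {N} c → 1 ≤ c → (multiPoch p c *ₛ dilate (poch c c)) ≈[ N ] poch c c
  multiPoch-dilate {N} c 1≤c = ≈-trans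
    (*-congˡ (multiPoch p c) (≈-trans (dilate-poch {N} {c} {c} 1≤c 1≤c) (reflexive (cong (λ i → poch i i) (ℕ.*-comm p c)))))
    (multiPoch-poch p c (ℕ.>-nonZero⁻¹ p) 1≤c)
    where open Truncated N

  module _ {N : ℕ} where
    open Truncated N

    dilate-product : ∀ {Θ f g h} → (∀ {N} → (Θ *ₛ f) ≈[ N ] (g *ₛ h)) → (dilate Θ *ₛ dilate f) ≈ (dilate g *ₛ dilate h)
    dilate-product {Θ} {f} {g} {h} Θf≈gh = ≈-trans (≈-sym (≈ₛ⇒≈ (dilate-*ₛ Θ f)))
      (≈-trans (dilate-cong (Θf≈gh {N})) (≈ₛ⇒≈ (dilate-*ₛ g h)))

  Θ₁-equation : ∀ {γ} → γ ≈ₛ Aₚ p → (γ *ₛ dilate Θ₁) ≈ₛ Θ₁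
  Θ₁-equation {γ} γ≈A = ≈⇒≈ₛ λ N → let open Truncated N in begin
    γ *ₛ dilate Θ₁                   ≈⟨ *-cong (≈ₛ⇒≈ γ≈A) (dilate-cong (≈-sym euler-pentagonal)) ⟩
    Aₚ p *ₛ dilate (poch 1 1)        ≈⟨ multiPoch-dilate 1 (s≤s z≤n) ⟩
    poch 1 1                         ≈⟨ euler-pentagonal ⟩
    Θ₁                               ∎

  -- Serves γ₂ with (c, d) = (1, 2) and γ₃ with (2, 1). Multiplying by E(q^d) makes both known
  -- products appear: γ pairs with the denominator B, Θ(q^p) with E(q^(dp)), and what results is
  -- E(q^c)² = Θ(q) E(q^d).
  quotient-equation : ∀ {c d γ Θ} → 1 ≤ c → 1 ≤ d → poch d d 0 ≡ + 1 →
    (∀ {N} → (Θ *ₛ poch d d) ≈[ N ] (poch c c *ₛ poch c c)) →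
    (γ *ₛ multiPoch p d) ≈ₛ (multiPoch p c *ₛ multiPoch p c) → (γ *ₛ dilate Θ) ≈ₛ Θ
  quotient-equation {c} {d} {γ} {Θ} 1≤c 1≤d E0≡1 ΘE≈ γB≈ = *ₛ-cancelʳ (γ *ₛ dilate Θ) Θ (poch d d) E0≡1
    (≈⇒≈ₛ λ N → let open Truncated N in begin
      (γ *ₛ dilate Θ) *ₛ poch d d
        ≈⟨ *-congˡ (γ *ₛ dilate Θ) (multiPoch-dilate d 1≤d) ⟨
      (γ *ₛ dilate Θ) *ₛ (B *ₛ dilate (poch d d))
        ≈⟨ solve 4 (λ g t b e → (g :* t) :* (b :* e) := (g :* b) :* (t :* e)) ≈-refl γ (dilate Θ) B (dilate (poch d d)) ⟩
      (γ *ₛ B) *ₛ (dilate Θ *ₛ dilate (poch d d))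
        ≈⟨ *-cong (≈ₛ⇒≈ γB≈) (dilate-product {Θ = Θ} {poch d d} {poch c c} {poch c c} (λ {N} → ΘE≈ {N})) ⟩
      (A *ₛ A) *ₛ (dilate (poch c c) *ₛ dilate (poch c c))
        ≈⟨ solve 2 (λ a e → (a :* a) :* (e :* e) := (a :* e) :* (a :* e)) ≈-refl A (dilate (poch c c)) ⟩
      (A *ₛ dilate (poch c c)) *ₛ (A *ₛ dilate (poch c c))
        ≈⟨ *-cong (multiPoch-dilate c 1≤c) (multiPoch-dilate c 1≤c) ⟩
      poch c c *ₛ poch c c
        ≈⟨ ΘE≈ ⟨
      Θ *ₛ poch d d ∎)
    where
    A B : Series
    A = multiPoch p c
    B = multiPoch p d

-- Division with remainder of the offset r by p supplies the r₁ and r₀ < p that the section argument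
-- requires.
theta-reciprocal : ∀ {p} → Prime p → .{{_ : NonZero p}} → ∀ {M c r g χ γ γ′} → c < M → ¬ p ∣ M →
  M ℕ.* r ℕ.+ c ≡ p ℕ.* p ℕ.* c → (∀ w → g (w ℕ.* p) ≡ χ ℤ.* g w) → theta M c g 0 ≡ + 1 →
  (γ *ₛ γ′) ≈ₛ oneₛ → (γ *ₛ Dilation.dilate p (theta M c g)) ≈ₛ theta M c g →
  ∀ n → γ (p ℕ.* n ℕ.+ r) ≡ χ ℤ.* γ′ n
theta-reciprocal {p} p-prime {M} {c} {r} {g} {χ} {γ} {γ′} c<M p∤M offset g-* Θ0≡1 γγ′≈1 γΘ≈Θ n = trans (cong γ index)
  (section-reciprocal p {γ} {γ′} {theta M c g} {χ} {r ℕ.% p} {r ℕ./ p} γγ′≈1 γΘ≈Θ Θ0≡1 (m%n<n r p)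
    (theta-section p-prime {r₀ = r ℕ.% p} {r ℕ./ p} c<M p∤M (trans (cong (λ i → M ℕ.* i ℕ.+ c) (sym r-split)) offset) {g} {χ} g-*) n)
  where
  r-split : r ≡ (r ℕ./ p) ℕ.* p ℕ.+ r ℕ.% p
  r-split = trans (m≡m%n+[m/n]*n r p) (ℕ.+-comm (r ℕ.% p) _)
  lemma : ∀ p n a b → p ℕ.* n ℕ.+ (a ℕ.* p ℕ.+ b) ≡ (a ℕ.+ n) ℕ.* p ℕ.+ b
  lemma = solve-∀
  index : p ℕ.* n ℕ.+ r ≡ (r ℕ./ p ℕ.+ n) ℕ.* p ℕ.+ r ℕ.% p
  index = trans (cong (p ℕ.* n ℕ.+_) r-split) (lemma p n (r ℕ./ p) (r ℕ.% p))

-- Residues of p, exact offsets and the sign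

offset-exact : ∀ {p} M m .{{_ : NonZero M}} → p ℕ.* p ≡ 1 ℕ.+ m ℕ.* M →
               M ℕ.* ((p ℕ.* p ℕ.∸ 1) ℕ./ M) ℕ.+ 1 ≡ p ℕ.* p ℕ.* 1
offset-exact {p} M m p²≡ = begin
  M ℕ.* ((p ℕ.* p ℕ.∸ 1) ℕ./ M) ℕ.+ 1     ≡⟨ cong (λ i → M ℕ.* ((i ℕ.∸ 1) ℕ./ M) ℕ.+ 1) p²≡ ⟩
  M ℕ.* (m ℕ.* M ℕ./ M) ℕ.+ 1             ≡⟨ cong (λ i → M ℕ.* i ℕ.+ 1) (m*n/n≡m m M) ⟩
  M ℕ.* m ℕ.+ 1                           ≡⟨ lemma M m ⟩
  1 ℕ.+ m ℕ.* M                           ≡⟨ p²≡ ⟨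
  p ℕ.* p                                 ≡⟨ ℕ.*-identityʳ (p ℕ.* p) ⟨
  p ℕ.* p ℕ.* 1                           ∎
  where
  open ≡-Reasoning
  lemma : ∀ M m → M ℕ.* m ℕ.+ 1 ≡ 1 ℕ.+ m ℕ.* M
  lemma = solve-∀

epsilon-5 : ∀ p e → p ℕ.% 6 ≡ 5 → p ℕ.+ 1 ≡ e ℕ.* 6 → epsilon p ≡ e
epsilon-5 p e p%6≡5 p+1≡ with p ℕ.% 6 ℕ.≟ 5
... | yes _     = trans (cong (ℕ._/ 6) p+1≡) (m*n/n≡m e 6)
... | no  p%6≢5 = ⊥-elim (p%6≢5 p%6≡5)

epsilon-1 : ∀ p e → p ℕ.% 6 ≡ 1 → p ≡ 1 ℕ.+ e ℕ.* 6 → epsilon p ≡ e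
epsilon-1 p e p%6≡1 p≡ with p ℕ.% 6 ℕ.≟ 5
... | yes p%6≡5 with () ← trans (sym p%6≡1) p%6≡5
... | no  _     = trans (cong (λ i → (i ℕ.∸ 1) ℕ./ 6) p≡) (m*n/n≡m e 6)

module _ {p : ℕ} (p-prime : Prime p) where

  proper∤ : ∀ {d} → 1 < d → d < p → ¬ d ∣ p
  proper∤ 1<d d<p d∣p with prime⇒irreducible p-prime d∣p
  ... | inj₁ d≡1 = ℕ.<⇒≢ 1<d (sym d≡1)
  ... | inj₂ d≡p = ℕ.<⇒≢ d<p d≡p

  odd⇒2< : p ℕ.% 2 ≡ 1 → 2 < p
  odd⇒2< p%2≡1 = ℕ.≤∧≢⇒< (ℕ.nonTrivial⇒n>1 p {{prime⇒nonTrivial p-prime}}) λ where refl → case p%2≡1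
    where
    case : 0 ≢ 1
    case ()

  ∤-* : ∀ {m n} → ¬ p ∣ m → ¬ p ∣ n → ¬ p ∣ m ℕ.* n
  ∤-* {m} {n} p∤m p∤n p∣mn with euclidsLemma m n p-prime p∣mn
  ... | inj₁ p∣m = p∤m p∣m
  ... | inj₂ p∣n = p∤n p∣n

  module _ (2<p : 2 < p) where

    ∤8 : ¬ p ∣ 8
    ∤8 = ∤-* {2} {4} (>⇒∤ 2<p) (∤-* {2} {2} (>⇒∤ 2<p) (>⇒∤ 2<p))

    ∤24 : 3 < p → ¬ p ∣ 24
    ∤24 3<p = ∤-* {8} {3} ∤8 (>⇒∤ 3<p)

    -- The residue modulo 6 selects the formula for ε, but its parity depends on p modulo 12. For p
    -- = 12k + 1, 5, 7, 11, ε is 2k, 2k + 1, 2k + 1, 2k + 2, which matches the signs of χ₁₂; the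
    -- other residues share a factor 2 or 3 with p.
    coprime-to-6 : 3 < p → ∀ r k → r < 12 → p ≡ r ℕ.+ k ℕ.* 12 →
                   (∃ λ m → p ℕ.* p ≡ 1 ℕ.+ m ℕ.* 24) × χ₁₂ p ≡ [-1]^ (epsilon p)
    coprime-to-6 3<p = λ where
        0  k _ p≡ → even 0 k p≡
        1  k _ refl → (k ℕ.+ 6 ℕ.* (k ℕ.* k) , square₁ k) ,
          character (k ℕ.* 2) 1 (lemma 1 k) (ℤ.*-identityʳ _)
            (epsilon-1 (1 ℕ.+ k ℕ.* 12) (k ℕ.* 2) (residue 1 k) (mod6 1 k))
        2  k _ p≡ → even 1 k p≡
        3  k _ p≡ → triple 1 k p≡
        4  k _ p≡ → even 2 k p≡
        5  k _ refl → (1 ℕ.+ 5 ℕ.* k ℕ.+ 6 ℕ.* (k ℕ.* k) , square₅ k) ,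
          character (k ℕ.* 2) 5 (lemma 5 k) (ℤ.*-comm ([-1]^ (k ℕ.* 2)) -[1+ 0 ])
            (epsilon-5 (5 ℕ.+ k ℕ.* 12) (1 ℕ.+ k ℕ.* 2) (residue 5 k) (next₅ k))
        6  k _ p≡ → even 3 k p≡
        7  k _ refl → (2 ℕ.+ 7 ℕ.* k ℕ.+ 6 ℕ.* (k ℕ.* k) , square₇ k) ,
          character (k ℕ.* 2) 7 (lemma 7 k) (ℤ.*-comm ([-1]^ (k ℕ.* 2)) -[1+ 0 ])
            (epsilon-1 (7 ℕ.+ k ℕ.* 12) (1 ℕ.+ k ℕ.* 2) (residue 7 k) (previous₇ k))
        8  k _ p≡ → even 4 k p≡
        9  k _ p≡ → triple 3 k p≡
        10 k _ p≡ → even 5 k p≡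
        11 k _ refl → (5 ℕ.+ 11 ℕ.* k ℕ.+ 6 ℕ.* (k ℕ.* k) , square₁₁ k) ,
          character (k ℕ.* 2) 11 (lemma 11 k) (twice ([-1]^ (k ℕ.* 2)))
            (epsilon-5 (11 ℕ.+ k ℕ.* 12) (2 ℕ.+ k ℕ.* 2) (residue 11 k) (next₁₁ k))
        (suc (suc (suc (suc (suc (suc (suc (suc (suc (suc (suc (suc r)))))))))))) k
          (s≤s (s≤s (s≤s (s≤s (s≤s (s≤s (s≤s (s≤s (s≤s (s≤s (s≤s (s≤s ())))))))))))) _
      where
      even : ∀ h k {G : Set} → p ≡ h ℕ.* 2 ℕ.+ k ℕ.* 12 → G
      even h k p≡ = ⊥-elim (proper∤ (s≤s (s≤s z≤n)) 2<p (divides (h ℕ.+ k ℕ.* 6) (trans p≡ (factor₂ h k))))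
        where
        factor₂ : ∀ h k → h ℕ.* 2 ℕ.+ k ℕ.* 12 ≡ (h ℕ.+ k ℕ.* 6) ℕ.* 2
        factor₂ = solve-∀
      triple : ∀ h k {G : Set} → p ≡ h ℕ.* 3 ℕ.+ k ℕ.* 12 → G
      triple h k p≡ = ⊥-elim (proper∤ (s≤s (s≤s z≤n)) 3<p (divides (h ℕ.+ k ℕ.* 4) (trans p≡ (factor₃ h k))))
        where
        factor₃ : ∀ h k → h ℕ.* 3 ℕ.+ k ℕ.* 12 ≡ (h ℕ.+ k ℕ.* 4) ℕ.* 3
        factor₃ = solve-∀
      character : ∀ j r {e} → p ≡ j ℕ.* 6 ℕ.+ r → [-1]^ j ℤ.* χ₁₂ r ≡ [-1]^ e → epsilon p ≡ e → χ₁₂ p ≡ [-1]^ (epsilon p)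
      character j r p≡ χr≡ ε≡e = trans (cong χ₁₂ p≡) (trans (χ₁₂-shift j r) (trans χr≡ (cong [-1]^ (sym ε≡e))))
      twice : ∀ s → s ℤ.* + 1 ≡ -[1+ 0 ] ℤ.* (-[1+ 0 ] ℤ.* s)
      twice = solve 1 (λ s → s :* con (+ 1) := con -[1+ 0 ] :* (con -[1+ 0 ] :* s)) refl
        where open ℤ.+-*-Solver
      lemma : ∀ r k → r ℕ.+ k ℕ.* 12 ≡ k ℕ.* 2 ℕ.* 6 ℕ.+ r
      lemma = solve-∀
      mod6 : ∀ r k → r ℕ.+ k ℕ.* 12 ≡ r ℕ.+ k ℕ.* 2 ℕ.* 6
      mod6 = solve-∀
      residue : ∀ r k → (r ℕ.+ k ℕ.* 12) ℕ.% 6 ≡ r ℕ.% 6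
      residue r k = trans (cong (ℕ._% 6) (mod6 r k)) ([m+kn]%n≡m%n r (k ℕ.* 2) 6)
      next₅ : ∀ k → 5 ℕ.+ k ℕ.* 12 ℕ.+ 1 ≡ (1 ℕ.+ k ℕ.* 2) ℕ.* 6
      next₅ = solve-∀
      previous₇ : ∀ k → 7 ℕ.+ k ℕ.* 12 ≡ 1 ℕ.+ (1 ℕ.+ k ℕ.* 2) ℕ.* 6
      previous₇ = solve-∀
      next₁₁ : ∀ k → 11 ℕ.+ k ℕ.* 12 ℕ.+ 1 ≡ (2 ℕ.+ k ℕ.* 2) ℕ.* 6
      next₁₁ = solve-∀
      square₁ : ∀ k → (1 ℕ.+ k ℕ.* 12) ℕ.* (1 ℕ.+ k ℕ.* 12) ≡ 1 ℕ.+ (k ℕ.+ 6 ℕ.* (k ℕ.* k)) ℕ.* 24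
      square₁ = solve-∀
      square₅ : ∀ k → (5 ℕ.+ k ℕ.* 12) ℕ.* (5 ℕ.+ k ℕ.* 12) ≡ 1 ℕ.+ (1 ℕ.+ 5 ℕ.* k ℕ.+ 6 ℕ.* (k ℕ.* k)) ℕ.* 24
      square₅ = solve-∀
      square₇ : ∀ k → (7 ℕ.+ k ℕ.* 12) ℕ.* (7 ℕ.+ k ℕ.* 12) ≡ 1 ℕ.+ (2 ℕ.+ 7 ℕ.* k ℕ.+ 6 ℕ.* (k ℕ.* k)) ℕ.* 24
      square₇ = solve-∀
      square₁₁ : ∀ k → (11 ℕ.+ k ℕ.* 12) ℕ.* (11 ℕ.+ k ℕ.* 12) ≡ 1 ℕ.+ (5 ℕ.+ 11 ℕ.* k ℕ.+ 6 ℕ.* (k ℕ.* k)) ℕ.* 24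
      square₁₁ = solve-∀

-- An odd multiplier preserves the parity of w. The value w = 0 is separate because its coefficient
-- is not doubled, and it is mapped to itself.
doubled-*-odd : ∀ h w → doubled (w ℕ.* (1 ℕ.+ h ℕ.* 2)) ≡ + 1 ℤ.* doubled w
doubled-*-odd h zero    = refl
doubled-*-odd h (suc w) = trans (cong (λ x → x ℤ.+ x) sign) (sym (ℤ.*-identityˡ _))
  where
  sign : [-1]^ (suc w ℕ.* (1 ℕ.+ h ℕ.* 2)) ≡ [-1]^ (suc w)
  sign = begin
    [-1]^ (suc w ℕ.* (1 ℕ.+ h ℕ.* 2))        ≡⟨ cong [-1]^ (ℕ.*-comm (suc w) (1 ℕ.+ h ℕ.* 2)) ⟩
    [-1]^ ((1 ℕ.+ h ℕ.* 2) ℕ.* suc w)        ≡⟨ ℤ.^-*-assoc -[1+ 0 ] (1 ℕ.+ h ℕ.* 2) (suc w) ⟨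
    [-1]^ (1 ℕ.+ h ℕ.* 2) ℤ.^ suc w          ≡⟨ cong (λ x → (-[1+ 0 ] ℤ.* x) ℤ.^ suc w) ([-1]^-even h) ⟩
    [-1]^ (suc w)                            ∎
    where open ≡-Reasoning

-- Identifies the offset (p² - 1)/8 as the triangular number of (p - 1)/2.
odd-square : ∀ h → (1 ℕ.+ h ℕ.* 2) ℕ.* (1 ℕ.+ h ℕ.* 2) ≡ 1 ℕ.+ tri h ℕ.* 8
odd-square h = trans (lemma₁ h) (trans (cong (λ i → 1 ℕ.+ i ℕ.* 4) (sym (tri-double h))) (lemma₂ (tri h)))
  where
  lemma₁ : ∀ h → (1 ℕ.+ h ℕ.* 2) ℕ.* (1 ℕ.+ h ℕ.* 2) ≡ 1 ℕ.+ h ℕ.* suc h ℕ.* 4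
  lemma₁ = solve-∀
  lemma₂ : ∀ t → 1 ℕ.+ 2 ℕ.* t ℕ.* 4 ≡ 1 ℕ.+ t ℕ.* 8
  lemma₂ = solve-∀

theorem1p1 : ∀ (p : ℕ) → Prime p → p ℕ.% 2 ≡ 1 →
    ((γ₁ γ₁′ : Series) → γ₁ ≈ₛ Aₚ p → (γ₁ *ₛ γ₁′) ≈ₛ oneₛ →
    3 < p → ∀ n → γ₁ (p ℕ.* n ℕ.+ (p ℕ.* p ℕ.∸ 1) ℕ./ 24) ≡ (-[1+ 0 ] ℤ.^ epsilon p) ℤ.* γ₁′ n)
    × ((γ₂ γ₂′ : Series) → (γ₂ *ₛ Bₚ p) ≈ₛ (Aₚ p *ₛ Aₚ p) → (γ₂ *ₛ γ₂′) ≈ₛ oneₛ →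
    ∀ n → γ₂ (p ℕ.* n) ≡ γ₂′ n)
    × ((γ₃ γ₃′ : Series) → (γ₃ *ₛ Aₚ p) ≈ₛ (Bₚ p *ₛ Bₚ p) → (γ₃ *ₛ γ₃′) ≈ₛ oneₛ →
    ∀ n → γ₃ (p ℕ.* n ℕ.+ (p ℕ.* p ℕ.∸ 1) ℕ./ 8) ≡ γ₃′ n)
theorem1p1 p p-prime p%2≡1 = part₁ , part₂ , part₃
  where
  instance
    p≢0 : NonZero p
    p≢0 = prime⇒nonZero p-prime
  2<p : 2 < p
  2<p = odd⇒2< p-prime p%2≡1
  h : ℕ
  h = p ℕ./ 2
  p≡1+2h : p ≡ 1 ℕ.+ h ℕ.* 2
  p≡1+2h = trans (m≡m%n+[m/n]*n p 2) (cong (ℕ._+ h ℕ.* 2) p%2≡1)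

  part₁ : (γ₁ γ₁′ : Series) → γ₁ ≈ₛ Aₚ p → (γ₁ *ₛ γ₁′) ≈ₛ oneₛ →
    3 < p → ∀ n → γ₁ (p ℕ.* n ℕ.+ (p ℕ.* p ℕ.∸ 1) ℕ./ 24) ≡ (-[1+ 0 ] ℤ.^ epsilon p) ℤ.* γ₁′ n
  part₁ γ γ′ γ≈A γγ′≈1 3<p n with coprime-to-6 p-prime 2<p 3<p (p ℕ.% 12) (p ℕ./ 12) (m%n<n p 12) (m≡m%n+[m/n]*n p 12)
  ... | (m , p²≡) , χp≡ = theta-reciprocal p-prime {g = χ₁₂} {χ = [-1]^ (epsilon p)} {γ} {γ′}
    (s≤s (s≤s z≤n)) (∤24 p-prime 2<p 3<p) (offset-exact {p} 24 m p²≡)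
    (λ w → trans (cong χ₁₂ (ℕ.*-comm w p)) (trans (χ₁₂-* p w) (cong (ℤ._* χ₁₂ w) χp≡))) refl γγ′≈1 (Θ₁-equation p γ≈A) n

  part₂ : (γ₂ γ₂′ : Series) → (γ₂ *ₛ Bₚ p) ≈ₛ (Aₚ p *ₛ Aₚ p) → (γ₂ *ₛ γ₂′) ≈ₛ oneₛ →
    ∀ n → γ₂ (p ℕ.* n) ≡ γ₂′ n
  part₂ γ γ′ γB≈ γγ′≈1 n = trans (cong γ (sym (ℕ.+-identityʳ (p ℕ.* n)))) (trans
    -- With c = 0 the offset equation reads 0 = p² · 0, so the residue class extracted is that of 0.
    (theta-reciprocal p-prime {r = 0} {doubled} {+ 1} {γ} {γ′} (s≤s z≤n)
      (>⇒∤ (ℕ.<-trans (s≤s (s≤s z≤n)) 2<p)) (sym (ℕ.*-zeroʳ (p ℕ.* p)))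
      (λ w → trans (cong (λ i → doubled (w ℕ.* i)) p≡1+2h) (doubled-*-odd h w)) refl γγ′≈1
      (quotient-equation p {1} {2} {γ} {Θ₂} (s≤s z≤n) (s≤s z≤n) refl gauss-squares γB≈) n)
    (ℤ.*-identityˡ (γ′ n)))

  part₃ : (γ₃ γ₃′ : Series) → (γ₃ *ₛ Aₚ p) ≈ₛ (Bₚ p *ₛ Bₚ p) → (γ₃ *ₛ γ₃′) ≈ₛ oneₛ →
    ∀ n → γ₃ (p ℕ.* n ℕ.+ (p ℕ.* p ℕ.∸ 1) ℕ./ 8) ≡ γ₃′ n
  part₃ γ γ′ γA≈ γγ′≈1 n = trans
    (theta-reciprocal p-prime {g = λ _ → + 1} {χ = + 1} {γ} {γ′} (s≤s (s≤s z≤n)) (∤8 p-prime 2<p)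
      (offset-exact {p} 8 (tri h) (trans (cong (λ i → i ℕ.* i) p≡1+2h) (odd-square h))) (λ _ → refl) refl γγ′≈1
      (quotient-equation p {2} {1} {γ} {Θ₃} (s≤s z≤n) (s≤s z≤n) refl gauss-triangular γA≈) n)
    (ℤ.*-identityˡ (γ′ n))
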